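{- Consider the following setting. There is a deterministic algorithm $\mathcal{A}$ which, when executed by every agent in the model described in the context, with every agent knowing a common integer $N \geq 2$ that is an upper bound on the number $n$ of nodes of the graph, solves both the gathering problem and the leader election problem, and whose time complexity is bounded by a polynomial in $N$ and in $\ell$, where $\ell$ is the length of the binary representation of the smallest label among the agents.
   Context: Model: the network is an undirected connected graph with $n$ nodes whose nodes are anonymous (unlabeled); at each node $v$ of degree $d$, the incident edges carry distinct port numbers $0,\dots,d-1$ (port numbering is local, with no relation between the two port numbers of an edge). A team of at least two mobile agents starts at pairwise distinct nodes. Agents have distinct labels which are positive integers; each agent knows its own label but not the labels of others, and all agents execute the same deterministic algorithm, parameterized by the agent's label. Time proceeds in synchronous rounds. An adversary wakes up some agents in possibly different rounds; a dormant agent is woken up when another agent first visits its starting node. Starting from its wake-up round, in each round an agent performs local computation and then either stays at its current node or moves to a neighbor through a chosen port. Upon entering a node, an agent learns its degree and the port of entry. Agents cannot mark nodes or edges, and agents crossing each other on an edge do not notice it. Agents have unlimited memory. Crucially, agents cannot communicate: co-located agents cannot see each other's labels nor exchange any information; the only information an agent gets about other agents is, in every round, the number of agents (including itself) present at the node it currently occupies. Agents see nothing outside their current node. The time complexity of an algorithm is the worst-case number of rounds from the wake-up of the earliest agent until the completion of the algorithm. Gathering problem: all agents must be at the same node and declare that they have all met (gathering is achieved). Leader election problem: one agent is elected as leader and all agents learn its label. -}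

module Defs where

open import Data.Nat using (ℕ; zero; suc; _+_; _*_; _^_; _≤_; _<_; _<?_; _≤ᵇ_)
open import Data.Nat.Logarithm using (⌊log₂_⌋)
open import Data.Fin using (Fin; toℕ; fromℕ<; _≟_)
open import Data.List using (List; []; _∷_; _++_; [_]; length; filter)
open import Data.List.Base using (allFin)
open import Data.Maybe using (Maybe; just; nothing)
open import Data.Bool using (Bool; true; false; if_then_else_; _∨_)
open import Data.Product using (Σ; _×_; _,_; ∃)
open import Relation.Nullary using (¬_; yes; no)
open import Relation.Binary.PropositionalEquality using (_≡_; _≢_)

-- Port-numbered undirected simple graphs on nodes Fin n.
-- Node v has degree deg v; port p at v leads to node nbr v p, and the
-- same edge has port back v p at the other endpoint.

record PortGraph (n : ℕ) : Set where
  field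
    deg       : Fin n → ℕ
    nbr       : (v : Fin n) → Fin (deg v) → Fin n
    back      : (v : Fin n) (p : Fin (deg v)) → Fin (deg (nbr v p))
    nbr-back  : ∀ v p → nbr (nbr v p) (back v p) ≡ v
    back-back : ∀ v p → toℕ (back (nbr v p) (back v p)) ≡ toℕ p
    no-loop   : ∀ v p → nbr v p ≢ v
    no-multi  : ∀ v p q → nbr v p ≡ nbr v q → p ≡ q

open PortGraph public

data Reachable {n : ℕ} (G : PortGraph n) : Fin n → Fin n → Set where
  here : ∀ {v} → Reachable G v v
  edge : ∀ {u w} (p : Fin (deg G u)) → Reachable G (nbr G u p) w → Reachable G u w

Connected : {n : ℕ} → PortGraph n → Set
Connected {n} G = ∀ (u v : Fin n) → Reachable G u v

-- What an agent perceives in a round: degree of its current node, the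
-- port by which it entered this node in the last round (nothing if it did
-- not move in the last round, or has just been woken up), and the number
-- of agents (including itself) at its current node.
record Obs : Set where
  constructor obs
  field
    degree : ℕ
    entry  : Maybe ℕ
    count  : ℕ

-- stay idle; move through a port; terminate, declaring gathering and
-- outputting the label of the elected leader.
data Action : Set where
  stay : Action
  move : ℕ → Action
  stop : ℕ → Action

-- A deterministic algorithm: given the known bound N, the agent's own
-- label and its whole history of observations since wake-up (unlimited
-- memory), it chooses the action of the current round.
Algorithm : Set
Algorithm = ℕ → ℕ → List Obs → Action

data Mode : Set where
  dormant : Mode
  active  : List Obs → Mode
  stopped : ℕ → Mode            -- terminated, with output (leader label)

isStopped : Mode → Bool
isStopped (stopped _) = true
isStopped _           = false

record AState (n : ℕ) : Set where
  constructor ⟨_,_,_⟩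
  field
    pos       : Fin n
    lastEntry : Maybe ℕ
    mode      : Mode

open AState public

-- The synchronous execution.  config t is the configuration at the
-- beginning of round t; the actions chosen in round t determine config (t+1).

module Execution (A : Algorithm) (N : ℕ) {n : ℕ} (G : PortGraph n)
                 (k : ℕ) (label : Fin k → ℕ) (start : Fin k → Fin n)
                 (wake : Fin k → Maybe ℕ) where

  Config : Set
  Config = Fin k → AState n

  countAt : Config → Fin n → ℕ
  countAt c v = length (filter (λ j → pos (c j) ≟ v) (allFin k))

  observe : Config → Fin k → Obs
  observe c i = obs (deg G (pos (c i))) (lastEntry (c i)) (countAt c (pos (c i)))

  -- performing an action (a move through a non-existing port is a stay)
  perform : AState n → List Obs → Action → AState n
  perform s h stay     = ⟨ pos s , nothing , active h ⟩
  perform s h (move p) with p <? deg G (pos s)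
  ... | yes lt = ⟨ nbr G (pos s) (fromℕ< lt)
                 , just (toℕ (back G (pos s) (fromℕ< lt))) , active h ⟩
  ... | no _   = ⟨ pos s , nothing , active h ⟩
  perform s h (stop o) = ⟨ pos s , nothing , stopped o ⟩

  act : Fin k → AState n → List Obs → AState n
  act i s h = perform s h (A N (label i) h)

  adversaryWakes : Maybe ℕ → ℕ → Bool
  adversaryWakes nothing  t = false
  adversaryWakes (just w) t = w ≤ᵇ t

  stepAgent : ℕ → Config → Fin k → Mode → AState n
  stepAgent t c i dormant =
    if adversaryWakes (wake i) t ∨ (2 ≤ᵇ countAt c (pos (c i)))
    then act i (c i) [ observe c i ]
    else c i
  stepAgent t c i (active h)  = act i (c i) (h ++ [ observe c i ])
  stepAgent t c i (stopped o) = c i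

  step : ℕ → Config → Config
  step t c i = stepAgent t c i (mode (c i))

  config : ℕ → Config
  config zero    i = ⟨ start i , nothing , dormant ⟩
  config (suc t) = step t (config t)

  Gathered : Config → Set
  Gathered c = ∀ i j → pos (c i) ≡ pos (c j)

  SolvesWithin : ℕ → ℕ → Set
  SolvesWithin t0 T =
      (∀ t i → isStopped (mode (config t i)) ≡ false →
               isStopped (mode (config (suc t) i)) ≡ true →
               Gathered (config t))
    × (∃ λ (ldr : Fin k) → ∀ t j o → mode (config t j) ≡ stopped o → o ≡ label ldr)
    × (∀ i → isStopped (mode (config (t0 + T) i)) ≡ true)

bitLength : ℕ → ℕ
bitLength x = suc ⌊log₂ x ⌋

{-# OPTIONS --safe #-}

-- Exploration.  Identify a word over {0,…,N−1} with the walk that takes the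
-- listed ports and stays put when a port does not exist.  The walk with random
-- letters has the uniform stationary distribution, so by a Kac-type counting
-- argument it hits a neighbour of its starting node within polynomial expected
-- time, hence any node, by moving along a simple path; derandomising over all
-- transition tables on at most N states yields one word w of polynomial length
-- that explores every connected graph on at most N nodes.
--
-- Gathering.  Every agent first follows w and returns to its start, which wakes
-- everybody up, so from then on all clocks agree up to |w| + 1.  In sufficiently
-- padded time slots, "follow w and return" versus "sit and watch the count" is a
-- shared beep channel: an agent sitting at its (private) starting node sees
-- company if and only if some agent is exploring.  Beeping "my label is below θ"
-- lets everybody find the smallest label by doubling and bisection.  Its owner
-- then walks along w, one step per slot; an agent that sees company at its start
-- joins, and since it knows w and the slot number it can keep following the
-- leader without any communication.  After |w| slots everybody has been met.
module Submission where

open import Defs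
open import Data.Bool using (Bool; true; false; if_then_else_; _∨_; T)
open import Data.Bool.Properties using (T-≡; ∨-zeroʳ)
open import Data.Fin using (Fin; zero; suc; toℕ; fromℕ<)
import Data.Fin as Fin
import Data.Fin.Properties as Fin
open import Data.List using (List; []; _∷_; [_]; _++_; length; map; filter; replicate; foldl; allFin; cartesianProduct; cartesianProductWith)
import Data.List as List
import Data.List.Membership.DecPropositional as DecMembership
open import Data.List.Membership.Propositional using (_∈_)
open import Data.List.Membership.Propositional.Properties using (∈-allFin; ∈-cartesianProduct⁺; ∈-cartesianProductWith⁺; ∈-filter⁺; ∈-filter⁻; ∈-lookup)
import Data.List.Properties as List
open import Data.List.Relation.Unary.All using (All; []; _∷_)
import Data.List.Relation.Unary.All as All
import Data.List.Relation.Unary.All.Properties as All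
open import Data.List.Relation.Unary.AllPairs using ([]; _∷_)
open import Data.List.Relation.Unary.Any using (here; there)
open import Data.List.Relation.Unary.Unique.Propositional using (Unique)
import Data.List.Relation.Unary.Unique.Propositional.Properties as Unique
open import Data.Maybe using (Maybe; just; nothing)
open import Data.Nat
import Data.Nat.ListAction as ListAction
open import Data.Nat.Logarithm using (⌊log₂_⌋; ⌊log₂⌋-mono-≤; ⌊log₂[2^n]⌋≡n)
open import Data.Nat.Properties
open import Algebra.Properties.Semiring.Sum +-*-semiring using (sum; sum-cong-≗; ∑-distrib-+; ∑-comm; *-distribˡ-sum; sum-replicate-zero)
open import Data.Nat.Tactic.RingSolver using (solve-∀)
open import Data.Product using (Σ; ∃; _×_; _,_; proj₁; proj₂)
open import Data.Sum using (_⊎_; inj₁; inj₂)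
open import Data.Vec using (Vec; []; _∷_; lookup; tabulate)
open import Data.Vec.Properties using (lookup∘tabulate)
open import Function using (_∘_; id)
open import Function.Bundles using (Equivalence)
open import Function.Definitions using (Injective)
open import Relation.Binary.PropositionalEquality hiding ([_])
open import Relation.Nullary using (Dec; does; yes; no; ¬_; contradiction)

-- Finite sums and indicators.

sum-mono : ∀ {n} {f g : Fin n → ℕ} → (∀ i → f i ≤ g i) → sum f ≤ sum g
sum-mono {zero}  f≤g = z≤n
sum-mono {suc n} f≤g = +-mono-≤ (f≤g zero) (sum-mono (f≤g ∘ suc))

sum-const : ∀ n x → sum {n} (λ _ → x) ≡ n * x
sum-const zero    x = refl
sum-const (suc n) x = cong (x +_) (sum-const n x)

sum-zero : ∀ {n} {f : Fin n → ℕ} → (∀ i → f i ≡ 0) → sum f ≡ 0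
sum-zero {n} f≡0 = trans (sum-cong-≗ f≡0) (sum-replicate-zero n)

term≤sum : ∀ {n} (f : Fin n → ℕ) i → f i ≤ sum f
term≤sum f zero    = m≤m+n _ _
term≤sum f (suc i) = ≤-trans (term≤sum (f ∘ suc) i) (m≤n+m _ _)

sum-drop : ∀ {n} {f g : Fin n → ℕ} v → (∀ i → f i ≤ g i) → f v ≡ 0 → sum f + g v ≤ sum g
sum-drop {f = f} {g} zero f≤g fv≡0 rewrite fv≡0 | +-comm (sum (f ∘ suc)) (g zero) =
  +-monoʳ-≤ (g zero) (sum-mono (f≤g ∘ suc))
sum-drop {f = f} {g} (suc v) f≤g fv≡0 rewrite +-assoc (f zero) (sum (f ∘ suc)) (g (suc v)) =
  +-mono-≤ (f≤g zero) (sum-drop v (f≤g ∘ suc) fv≡0)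

sum<⇒∃< : ∀ {n} (f : Fin n → ℕ) x → sum f < n * x → ∃ λ i → f i < x
sum<⇒∃< {suc n} f x lt with f zero <? x
... | yes f₀<x = zero , f₀<x
... | no  f₀≮x = let i , fi<x = sum<⇒∃< (f ∘ suc) x rest<  in suc i , fi<x
  where
  rest< : sum (f ∘ suc) < n * x
  rest< = +-cancelˡ-< x _ _ (≤-<-trans (+-monoˡ-≤ _ (≮⇒≥ f₀≮x)) lt)

indicator : ∀ {P : Set} → Dec P → ℕ
indicator P? = if does P? then 1 else 0

indicator-true : ∀ {P : Set} (P? : Dec P) → P → indicator P? ≡ 1
indicator-true (yes _) p = refl
indicator-true (no ¬p) p = contradiction p ¬p

indicator-false : ∀ {P : Set} (P? : Dec P) → ¬ P → indicator P? ≡ 0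
indicator-false (yes p) ¬p = contradiction p ¬p
indicator-false (no _)  ¬p = refl

sum-indicator-unique : ∀ {n} {P : Fin n → Set} (P? : ∀ i → Dec (P i)) →
  (∀ i j → P i → P j → i ≡ j) → sum (λ i → indicator (P? i)) ≤ 1
sum-indicator-unique {zero}  P? uniq = z≤n
sum-indicator-unique {suc n} P? uniq with P? zero
... | yes p = ≤-reflexive (cong suc (sum-zero λ i → indicator-false (P? (suc i)) λ q →
        contradiction (uniq zero (suc i) p q) λ ()))
... | no  _ = sum-indicator-unique (P? ∘ suc) λ i j p q → Fin.suc-injective (uniq _ _ p q)

sum-select : ∀ {n} (g : Fin n → ℕ) x → sum (λ y → indicator (x Fin.≟ y) * g y) ≡ g x
sum-select g zero = begin
  g zero + 0 + sum (λ y → indicator (zero Fin.≟ suc y) * g (suc y))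
    ≡⟨ cong (g zero + 0 +_) (sum-zero {f = λ y → indicator (zero Fin.≟ suc y) * g (suc y)} λ _ → refl) ⟩
  g zero + 0 + 0 ≡⟨ +-identityʳ _ ⟩
  g zero + 0     ≡⟨ +-identityʳ _ ⟩
  g zero ∎
  where open ≡-Reasoning
sum-select g (suc x) = trans (sum-cong-≗ same) (sum-select (g ∘ suc) x)
  where
  same : ∀ y → indicator (suc x Fin.≟ suc y) * g (suc y) ≡ indicator (x Fin.≟ y) * g (suc y)
  same y with x Fin.≟ y
  ... | yes _ = refl
  ... | no  _ = refl

-- Counting the words whose walk avoids a state.

module _ {n M : ℕ} (f : Fin n → Fin M → Fin n) where

  -- avoid v L x is the number of words of length L whose walk from x never
  -- visits v, and survive v L x the same number when x itself is disregarded.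
  avoid   : Fin n → ℕ → Fin n → ℕ
  survive : Fin n → ℕ → Fin n → ℕ
  avoid v L x = if does (x Fin.≟ v) then 0 else survive v L x
  survive v zero    x = 1
  survive v (suc L) x = sum λ c → avoid v L (f x c)

  avoid-hit : ∀ v L → avoid v L v ≡ 0
  avoid-hit v L with v Fin.≟ v
  ... | yes _  = refl
  ... | no v≢v = contradiction refl v≢v

  avoid-miss : ∀ {v x} L → x ≢ v → avoid v L x ≡ survive v L x
  avoid-miss {v} {x} L x≢v with x Fin.≟ v
  ... | yes x≡v = contradiction x≡v x≢v
  ... | no  _   = refl

  avoid≤survive : ∀ v L x → avoid v L x ≤ survive v L x
  avoid≤survive v L x with x Fin.≟ v
  ... | yes _ = z≤n
  ... | no  _ = ≤-refl

  -- Dropping the last letter of an avoiding word leaves an avoiding word, and that letter has `M`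
  -- values. The induction still peels first letters, following `survive`.
  avoid-suc : ∀ v L x → avoid v (suc L) x ≤ M * avoid v L x
  avoid-suc v L x with x Fin.≟ v
  ... | yes _ = z≤n
  avoid-suc v zero x | no _ = ≤-trans (sum-mono λ c → avoid≤survive v 0 (f x c)) (≤-reflexive (sum-const M 1))
  avoid-suc v (suc L) x | no _ = ≤-trans (sum-mono λ c → avoid-suc v L (f x c))
    (≤-reflexive (sym (*-distribˡ-sum M (λ c → avoid v L (f x c)))))

  avoid-+ : ∀ v a b x → avoid v (a + b) x ≤ M ^ a * avoid v b x
  avoid-+ v zero    b x = ≤-reflexive (sym (+-identityʳ _))
  avoid-+ v (suc a) b x = begin
    avoid v (suc a + b) x      ≤⟨ avoid-suc v (a + b) x ⟩
    M * avoid v (a + b) x      ≤⟨ *-monoʳ-≤ M (avoid-+ v a b x) ⟩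
    M * (M ^ a * avoid v b x)  ≡⟨ *-assoc M (M ^ a) _ ⟨
    M * M ^ a * avoid v b x    ∎
    where open ≤-Reasoning

  avoid≤^ : ∀ v L x → avoid v L x ≤ M ^ L
  avoid≤^ v zero    x = avoid≤survive v 0 x
  avoid≤^ v (suc L) x = ≤-trans (avoid-suc v L x) (*-monoʳ-≤ M (avoid≤^ v L x))

  -- A word that misses v either misses y in its first a letters, or is at y
  -- at some time ≤ a and then misses v during the following b letters.
  avoid-via : ∀ v y a b x → avoid v (a + b) x ≤ avoid y a x * M ^ b + M ^ a * avoid v b y
  avoid-via v y a b x with x Fin.≟ y
  ... | yes refl = avoid-+ v a b x
  avoid-via v y zero b x | no _ = ≤-trans (avoid≤^ v b x) (≤-trans (m≤m+n _ _) (m≤m+n _ _))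
  avoid-via v y (suc a) b x | no _ = begin
    avoid v (suc a + b) x
      ≤⟨ avoid≤survive v (suc a + b) x ⟩
    sum (λ c → avoid v (a + b) (f x c))
      ≤⟨ sum-mono (λ c → avoid-via v y a b (f x c)) ⟩
    sum (λ c → avoid y a (f x c) * M ^ b + M ^ a * avoid v b y)
      ≡⟨ ∑-distrib-+ (λ c → avoid y a (f x c) * M ^ b) _ ⟩
    sum (λ c → avoid y a (f x c) * M ^ b) + sum {M} (λ c → M ^ a * avoid v b y)
      ≡⟨ cong₂ _+_ (trans (sum-cong-≗ λ c → *-comm (avoid y a (f x c)) (M ^ b))
                     (trans (sym (*-distribˡ-sum (M ^ b) (λ c → avoid y a (f x c)))) (*-comm (M ^ b) _)))
                   (trans (sum-const M _) (sym (*-assoc M _ _))) ⟩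
    sum (λ c → avoid y a (f x c)) * M ^ b + M ^ suc a * avoid v b y ∎
    where open ≤-Reasoning

  -- Cut the word into `r` blocks: whatever state a block begins in, at most a fraction 1/`K` of its
  -- values avoid `v`. The auxiliary `go` reads the first block letter by letter and then applies
  -- the induction hypothesis at the state reached.
  avoid-power : ∀ v b K → (∀ x → K * avoid v b x ≤ M ^ b) →
                ∀ r x → K ^ r * avoid v (r * b) x ≤ M ^ (r * b)
  avoid-power v b K bound zero    x = ≤-trans (≤-reflexive (+-identityʳ _)) (avoid≤^ v 0 x)
  avoid-power v b K bound (suc r) x = begin
    K * K ^ r * avoid v (b + r * b) x     ≡⟨ *-assoc K (K ^ r) _ ⟩
    K * (K ^ r * avoid v (b + r * b) x)   ≤⟨ *-monoʳ-≤ K (go b x) ⟩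
    K * (avoid v b x * M ^ (r * b))       ≡⟨ *-assoc K _ _ ⟨
    K * avoid v b x * M ^ (r * b)         ≤⟨ *-monoˡ-≤ (M ^ (r * b)) (bound x) ⟩
    M ^ b * M ^ (r * b)                   ≡⟨ ^-distribˡ-+-* M b (r * b) ⟨
    M ^ (b + r * b) ∎
    where
    open ≤-Reasoning
    go : ∀ a x → K ^ r * avoid v (a + r * b) x ≤ avoid v a x * M ^ (r * b)
    go a x with x Fin.≟ v
    ... | yes _ = ≤-reflexive (*-zeroʳ (K ^ r))
    go zero x | no x≢v = begin
      K ^ r * survive v (r * b) x  ≡⟨ cong (K ^ r *_) (avoid-miss (r * b) x≢v) ⟨
      K ^ r * avoid v (r * b) x    ≤⟨ avoid-power v b K bound r x ⟩
      M ^ (r * b)                  ≡⟨ +-identityʳ _ ⟨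
      1 * M ^ (r * b) ∎
    go (suc a) x | no _ = begin
      K ^ r * sum (λ c → avoid v (a + r * b) (f x c))
        ≡⟨ *-distribˡ-sum (K ^ r) (λ c → avoid v (a + r * b) (f x c)) ⟩
      sum (λ c → K ^ r * avoid v (a + r * b) (f x c))
        ≤⟨ sum-mono (λ c → go a (f x c)) ⟩
      sum (λ c → avoid v a (f x c) * M ^ (r * b))
        ≡⟨ sum-cong-≗ (λ c → *-comm (avoid v a (f x c)) (M ^ (r * b))) ⟩
      sum (λ c → M ^ (r * b) * avoid v a (f x c))
        ≡⟨ *-distribˡ-sum (M ^ (r * b)) (λ c → avoid v a (f x c)) ⟨
      M ^ (r * b) * sum (λ c → avoid v a (f x c))
        ≡⟨ *-comm (M ^ (r * b)) _ ⟩
      sum (λ c → avoid v a (f x c)) * M ^ (r * b) ∎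

  module _ (balanced : ∀ g → sum (λ x → sum (λ c → g (f x c))) ≤ M * sum g) where

    -- `balanced` says that at most `M` pairs of state and letter lead into any given state, so
    -- summing `survive` over all states gives at most the right-hand side. Replacing `survive` by
    -- `avoid` discards the term at `v`, which has `avoid v L (f v c)` as a summand.
    total-loss : ∀ v c L → sum (avoid v (suc L)) + avoid v L (f v c) ≤ M * sum (avoid v L)
    total-loss v c L = begin
      sum (avoid v (suc L)) + avoid v L (f v c)
        ≤⟨ +-monoʳ-≤ (sum (avoid v (suc L))) (term≤sum (λ c → avoid v L (f v c)) c) ⟩
      sum (avoid v (suc L)) + survive v (suc L) v
        ≤⟨ sum-drop v (avoid≤survive v (suc L)) (avoid-hit v (suc L)) ⟩
      sum (λ x → sum (λ c → avoid v L (f x c)))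
        ≤⟨ balanced (avoid v L) ⟩
      M * sum (avoid v L) ∎
      where open ≤-Reasoning

    -- The normalised total Σₓ avoid v L x / M^L never exceeds n and drops by at
    -- least (avoid v L (f v c) / M^L) / M per letter, while the latter
    -- quantity is non-increasing in L.
    return-bound : ∀ v c L → L * avoid v L (f v c) + M * sum (avoid v L) ≤ n * M ^ suc L
    return-bound v c zero = begin
      M * sum (avoid v 0)  ≤⟨ *-monoʳ-≤ M (sum-mono (avoid≤survive v 0)) ⟩
      M * sum {n} (λ _ → 1) ≡⟨ cong (M *_) (trans (sum-const n 1) (*-identityʳ n)) ⟩
      M * n                ≡⟨ trans (*-comm M n) (cong (n *_) (sym (*-identityʳ M))) ⟩
      n * (M * 1) ∎
      where open ≤-Reasoning
    return-bound v c (suc L) = begin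
      suc L * avoid v (suc L) y + M * sum (avoid v (suc L))
        ≤⟨ +-monoˡ-≤ _ (*-monoʳ-≤ (suc L) (avoid-suc v L y)) ⟩
      suc L * (M * avoid v L y) + M * sum (avoid v (suc L))
        ≡⟨ rearrange L M (avoid v L y) (sum (avoid v (suc L))) ⟩
      M * (L * avoid v L y + (sum (avoid v (suc L)) + avoid v L y))
        ≤⟨ *-monoʳ-≤ M (+-monoʳ-≤ (L * avoid v L y) (total-loss v c L)) ⟩
      M * (L * avoid v L y + M * sum (avoid v L))
        ≤⟨ *-monoʳ-≤ M (return-bound v c L) ⟩
      M * (n * M ^ suc L)
        ≡⟨ exchange M n (M ^ suc L) ⟩
      n * (M * M ^ suc L) ∎
      where
      open ≤-Reasoning
      y = f v c
      rearrange : ∀ L M a s → suc L * (M * a) + M * s ≡ M * (L * a + (s + a))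
      rearrange = solve-∀
      exchange : ∀ a b c → a * (b * c) ≡ b * (a * c)
      exchange = solve-∀

    -- Markov's inequality for the return time: the length is `2 * P` times `P * M` so that
    -- `return-bound` can be divided by `P * M`. One letter after `v`, the walk then fails to return
    -- in time with probability at most 1/(2P).
    return-rarely-late : ∀ P .{{_ : NonZero P}} .{{_ : NonZero M}} → n ≤ P → ∀ v c →
      2 * P * avoid v (2 * P * (P * M)) (f v c) ≤ M ^ (2 * P * (P * M))
    return-rarely-late P n≤P v c = *-cancelˡ-≤ (P * M) {{m*n≢0 P M}} (begin
      P * M * (2 * P * a)  ≡⟨ exchange (P * M) (2 * P) a ⟩
      L * a                ≤⟨ m≤m+n _ _ ⟩
      L * a + M * sum (avoid v L) ≤⟨ return-bound v c L ⟩
      n * (M * M ^ L)      ≤⟨ *-monoˡ-≤ (M * M ^ L) n≤P ⟩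
      P * (M * M ^ L)      ≡⟨ *-assoc P M _ ⟨
      P * M * M ^ L        ∎)
      where
      open ≤-Reasoning
      L = 2 * P * (P * M)
      a = avoid v L (f v c)
      exchange : ∀ a b c → a * (b * c) ≡ b * a * c
      exchange = solve-∀

-- Port walks on graphs and random exploration.

data Path {n : ℕ} (G : PortGraph n) : Fin n → Fin n → List (Fin n) → Set where
  []  : ∀ {v} → Path G v v []
  _∷_ : ∀ {u v l} (p : Fin (deg G u)) → Path G (nbr G u p) v l → Path G u v (u ∷ l)

module _ {n : ℕ} (G : PortGraph n) where

  open DecMembership (Fin._≟_ {n}) using (_∈?_)

  suffix : ∀ {u x v l} → Path G x v l → Unique l → u ∈ l → ∃ λ l′ → Path G u v l′ × Unique l′
  suffix (p ∷ ps) uniq       (here refl) = _ , p ∷ ps , uniq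
  suffix (p ∷ ps) (_ ∷ uniq) (there u∈l) = suffix ps uniq u∈l

  simple-path : ∀ {u v} → Reachable G u v → ∃ λ l → Path G u v l × Unique l
  simple-path here = [] , [] , []
  simple-path {u} (edge p r) with simple-path r
  ... | l , ps , uniq with u ∈? l
  ...   | yes u∈l = suffix ps uniq u∈l
  ...   | no  u∉l = u ∷ l , p ∷ ps , All.¬Any⇒All¬ l u∉l ∷ uniq

  -- Agrees with `perform`, where a move through a missing port is a stay; thus every word is a walk
  -- on every graph.
  hop : Fin n → ℕ → Fin n
  hop v p with p <? deg G v
  ... | yes p<d = nbr G v (fromℕ< p<d)
  ... | no  _   = v

  hop-port : ∀ v p → hop v (toℕ p) ≡ nbr G v p
  hop-port v p with toℕ p <? deg G v
  ... | yes p<d = cong (nbr G v) (Fin.fromℕ<-toℕ p p<d)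
  ... | no  p≮d = contradiction (Fin.toℕ<n p) p≮d

  deg≤n : ∀ v → deg G v ≤ n
  deg≤n v = Fin.injective⇒≤ (no-multi G v _ _)

  hop-leaves : ∀ v p {w} → hop v p ≡ w → v ≢ w → Σ (Fin (deg G v)) λ q → toℕ q ≡ p × nbr G v q ≡ w
  hop-leaves v p v→w v≢w with p <? deg G v
  ... | yes p<d = fromℕ< p<d , Fin.toℕ-fromℕ< p<d , v→w
  ... | no  _   = contradiction v→w v≢w

unique⇒length≤ : ∀ {n} {l : List (Fin n)} → Unique l → length l ≤ n
unique⇒length≤ {l = l} uniq = Fin.injective⇒≤ (lookup-injective uniq)
  where
  lookup-injective : ∀ {l : List (Fin _)} → Unique l → Injective _≡_ _≡_ (List.lookup l)
  lookup-injective (x∉ ∷ uniq) {zero}  {zero}  eq = refl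
  lookup-injective (x∉ ∷ uniq) {zero}  {suc j} eq = contradiction eq (All.lookup x∉ (∈-lookup j))
  lookup-injective (x∉ ∷ uniq) {suc i} {zero}  eq = contradiction (sym eq) (All.lookup x∉ (∈-lookup i))
  lookup-injective (x∉ ∷ uniq) {suc i} {suc j} eq = cong suc (lookup-injective uniq eq)

module _ {n M : ℕ} (G : PortGraph n) (n≤M : n ≤ M) where

  private
    f : Fin n → Fin M → Fin n
    f x c = hop G x (toℕ c)

  -- The adjacency matrix of the `M`-regular multigraph in which missing ports become loops.
  arcs : Fin n → Fin n → ℕ
  arcs x y = sum λ c → indicator (f x c Fin.≟ y)

  nbr-letter : ∀ v p → ∃ λ c → f v c ≡ nbr G v p
  nbr-letter v p = fromℕ< p<M , trans (cong (hop G v) (Fin.toℕ-fromℕ< p<M)) (hop-port G v p)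
    where p<M = ≤-trans (Fin.toℕ<n p) (≤-trans (deg≤n G v) n≤M)

  reverse-letter : ∀ v p → ∃ λ c → f (nbr G v p) c ≡ v
  reverse-letter v p = let c , eq = nbr-letter (nbr G v p) (back G v p) in c , trans eq (nbr-back G v p)

  -- Off the diagonal, `no-multi` allows at most one letter from `x` to `y`, and if there is one,
  -- `back` provides a letter in the other direction.
  arcs-sym-≤ : ∀ x y → arcs x y ≤ arcs y x
  arcs-sym-≤ x y with x Fin.≟ y
  ... | yes refl = ≤-refl
  ... | no  x≢y with Fin.any? (λ c → f x c Fin.≟ y)
  ...   | no  none = ≤-trans (≤-reflexive (sum-zero λ c → indicator-false (f x c Fin.≟ y) λ eq → none (c , eq))) z≤n
  ...   | yes (c , fxc≡y) with hop-leaves G x (toℕ c) fxc≡y x≢y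
  ...     | p , _ , refl = begin
    arcs x y                              ≤⟨ sum-indicator-unique (λ c → f x c Fin.≟ y) unique ⟩
    1                                     ≡⟨ indicator-true (f y c′ Fin.≟ x) eq′ ⟨
    indicator (f y c′ Fin.≟ x)            ≤⟨ term≤sum (λ c → indicator (f y c Fin.≟ x)) c′ ⟩
    arcs y x ∎
    where
    open ≤-Reasoning
    c′ = proj₁ (reverse-letter x p)
    eq′ = proj₂ (reverse-letter x p)
    unique : ∀ c d → f x c ≡ y → f x d ≡ y → c ≡ d
    unique c d xc xd with hop-leaves G x (toℕ c) xc x≢y | hop-leaves G x (toℕ d) xd x≢y
    ... | q , q≡c , xq | r , r≡d , xr = Fin.toℕ-injective (trans (sym q≡c)
            (trans (cong toℕ (no-multi G x q r (trans xq (sym xr)))) r≡d))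

  -- The rows of `arcs` sum to `M`, so by symmetry its column sums are at most `M`. This is
  -- stationarity of the uniform distribution.
  hop-balanced : ∀ g → sum (λ x → sum (λ c → g (f x c))) ≤ M * sum g
  hop-balanced g = begin
    sum (λ x → sum (λ c → g (f x c)))
      ≡⟨ sum-cong-≗ (λ x → sum-cong-≗ (λ c → sym (sum-select g (f x c)))) ⟩
    sum (λ x → sum (λ c → sum (λ y → indicator (f x c Fin.≟ y) * g y)))
      ≡⟨ sum-cong-≗ (λ x → ∑-comm (λ c y → indicator (f x c Fin.≟ y) * g y)) ⟩
    sum (λ x → sum (λ y → sum (λ c → indicator (f x c Fin.≟ y) * g y)))
      ≡⟨ sum-cong-≗ (λ x → sum-cong-≗ (λ y → pull (λ c → indicator (f x c Fin.≟ y)) (g y))) ⟩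
    sum (λ x → sum (λ y → arcs x y * g y))
      ≤⟨ sum-mono (λ x → sum-mono (λ y → *-monoˡ-≤ (g y) (arcs-sym-≤ x y))) ⟩
    sum (λ x → sum (λ y → arcs y x * g y))
      ≡⟨ ∑-comm (λ x y → arcs y x * g y) ⟩
    sum (λ y → sum (λ x → arcs y x * g y))
      ≡⟨ sum-cong-≗ (λ y → pull (arcs y) (g y)) ⟩
    sum (λ y → sum (arcs y) * g y)
      ≡⟨ sum-cong-≗ (λ y → cong (_* g y) (out-arcs y)) ⟩
    sum (λ y → M * g y)
      ≡⟨ *-distribˡ-sum M g ⟨
    M * sum g ∎
    where
    open ≤-Reasoning
    pull : ∀ {m} (h : Fin m → ℕ) k → sum (λ i → h i * k) ≡ sum h * k
    pull h k = trans (sum-cong-≗ (λ i → *-comm (h i) k)) (trans (sym (*-distribˡ-sum k h)) (*-comm k (sum h)))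
    out-arcs : ∀ y → sum (arcs y) ≡ M
    out-arcs y = trans (∑-comm (λ x c → indicator (f y c Fin.≟ x)))
      (trans (sum-cong-≗ (λ c → trans (sum-cong-≗ (λ x → sym (*-identityʳ (indicator (f y c Fin.≟ x))))) (sum-select (λ _ → 1) (f y c))))
        (trans (sum-const M 1) (*-identityʳ M)))

  module _ (P : ℕ) .{{_ : NonZero P}} .{{_ : NonZero M}} (n≤P : n ≤ P) where

    private
      L = 2 * P * (P * M)

    -- Union bound along the path: each edge gets a block of `L` letters and fails to be crossed,
    -- possibly by a detour, with probability at most 1/(2P).
    path-bound : ∀ {u v l} → Path G u v l →
      2 * P * avoid f v (length l * L) u ≤ length l * M ^ (length l * L)
    path-bound {v = v} [] = ≤-reflexive (trans (cong (2 * P *_) (avoid-hit f v 0)) (*-zeroʳ (2 * P)))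
    path-bound {u} {v} {_ ∷ l} (p ∷ ps) = begin
      2 * P * avoid f v (L + m * L) u
        ≤⟨ *-monoʳ-≤ (2 * P) (avoid-via f v y L (m * L) u) ⟩
      2 * P * (avoid f y L u * M ^ (m * L) + M ^ L * avoid f v (m * L) y)
        ≡⟨ expand (2 * P) (avoid f y L u) (M ^ (m * L)) (M ^ L) (avoid f v (m * L) y) ⟩
      2 * P * avoid f y L u * M ^ (m * L) + M ^ L * (2 * P * avoid f v (m * L) y)
        ≤⟨ +-mono-≤ (*-monoˡ-≤ (M ^ (m * L)) first) (*-monoʳ-≤ (M ^ L) (path-bound ps)) ⟩
      M ^ L * M ^ (m * L) + M ^ L * (m * M ^ (m * L))
        ≡⟨ collect (M ^ L) (M ^ (m * L)) m ⟩
      suc m * (M ^ L * M ^ (m * L))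
        ≡⟨ cong (suc m *_) (^-distribˡ-+-* M L (m * L)) ⟨
      suc m * M ^ (L + m * L) ∎
      where
      open ≤-Reasoning
      m = length l
      y = nbr G u p
      -- The edge is read backwards: `u` is one letter away from `y`, so reaching `y` from `u` is a
      -- return to `y`.
      first : 2 * P * avoid f y L u ≤ M ^ L
      first = let c , fyc≡u = reverse-letter u p in
        subst (λ x → 2 * P * avoid f y L x ≤ M ^ L) fyc≡u (return-rarely-late f hop-balanced P n≤P y c)
      expand : ∀ k a b c d → k * (a * b + c * d) ≡ k * a * b + c * (k * d)
      expand = solve-∀
      collect : ∀ a b m → a * b + a * (m * b) ≡ suc m * (a * b)
      collect = solve-∀

    -- A simple path with m edges fails with probability at most m/(2P), hence at most 1/2. The
    -- other P - m blocks make the length independent of `u` and `v`.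
    half-avoid : Connected G → ∀ u v → 2 * avoid f v (P * L) u ≤ M ^ (P * L)
    half-avoid connected u v with simple-path G (connected u v)
    ... | l , path , uniq = begin
      2 * avoid f v (P * L) u
        ≡⟨ cong (λ k → 2 * avoid f v k u) split ⟩
      2 * avoid f v (r * L + m * L) u
        ≤⟨ *-monoʳ-≤ 2 (avoid-+ f v (r * L) (m * L) u) ⟩
      2 * (M ^ (r * L) * avoid f v (m * L) u)
        ≡⟨ exchange 2 (M ^ (r * L)) _ ⟩
      M ^ (r * L) * (2 * avoid f v (m * L) u)
        ≤⟨ *-monoʳ-≤ (M ^ (r * L)) (*-cancelˡ-≤ P short) ⟩
      M ^ (r * L) * M ^ (m * L)
        ≡⟨ ^-distribˡ-+-* M (r * L) (m * L) ⟨
      M ^ (r * L + m * L)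
        ≡⟨ cong (M ^_) split ⟨
      M ^ (P * L) ∎
      where
      open ≤-Reasoning
      m = length l
      -- The node list of a path omits its endpoint, so `m` is the number of edges.
      m≤P = ≤-trans (unique⇒length≤ uniq) n≤P
      r = P ∸ m
      split : P * L ≡ r * L + m * L
      split = trans (cong (_* L) (sym (m∸n+n≡m m≤P))) (*-distribʳ-+ L r m)
      exchange : ∀ a b c → a * (b * c) ≡ b * (a * c)
      exchange = solve-∀
      short : P * (2 * avoid f v (m * L) u) ≤ P * M ^ (m * L)
      short = ≤-trans (≤-reflexive (trans (exchange P 2 _) (sym (*-assoc 2 P _))))
        (≤-trans (path-bound path) (*-monoˡ-≤ (M ^ (m * L)) m≤P))

    avoid-rarely : Connected G → ∀ r u v → 2 ^ r * avoid f v (r * (P * L)) u ≤ M ^ (r * (P * L))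
    avoid-rarely connected r u v = avoid-power f v (P * L) 2 (λ x → half-avoid connected x v) r u

-- Derandomisation: one word for all transition tables.

Hits : ∀ {n} {A : Set} → (Fin n → A → Fin n) → Fin n → Fin n → List A → Set
Hits f v x []      = x ≡ v
Hits f v x (c ∷ w) = x ≡ v ⊎ Hits f v (f x c) w

hits-now : ∀ {n} {A : Set} {f : Fin n → A → Fin n} {v} w → Hits f v v w
hits-now []      = refl
hits-now (_ ∷ _) = inj₁ refl

vectors : ∀ {A : Set} → List A → ∀ m → List (Vec A m)
vectors xs zero    = [] ∷ []
vectors xs (suc m) = cartesianProductWith _∷_ xs (vectors xs m)

length-cartesianProductWith : ∀ {A B C : Set} (g : A → B → C) xs ys →
  length (cartesianProductWith g xs ys) ≡ length xs * length ys
length-cartesianProductWith g []       ys = refl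
length-cartesianProductWith g (x ∷ xs) ys = trans (List.length-++ (map (g x) ys))
  (cong₂ _+_ (List.length-map (g x) ys) (length-cartesianProductWith g xs ys))

length-vectors : ∀ {A : Set} (xs : List A) m → length (vectors xs m) ≡ length xs ^ m
length-vectors xs zero    = refl
length-vectors xs (suc m) = trans (length-cartesianProductWith _∷_ xs (vectors xs m))
  (cong (length xs *_) (length-vectors xs m))

∈-vectors : ∀ {A : Set} {xs : List A} → (∀ x → x ∈ xs) → ∀ {m} (v : Vec A m) → v ∈ vectors xs m
∈-vectors full []      = here refl
∈-vectors full (x ∷ v) = ∈-cartesianProductWith⁺ _∷_ (full x) (∈-vectors full v)

module _ {n M : ℕ} where

  avoid-cong : {f g : Fin n → Fin M → Fin n} → (∀ x c → f x c ≡ g x c) →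
               ∀ v L x → avoid f v L x ≡ avoid g v L x
  avoid-cong f≗g v L x with x Fin.≟ v
  ... | yes _ = refl
  avoid-cong f≗g v zero    x | no _ = refl
  avoid-cong {f} {g} f≗g v (suc L) x | no _ = sum-cong-≗ λ c →
    trans (avoid-cong f≗g v L (f x c)) (cong (avoid g v L) (f≗g x c))

  -- Vectors instead of functions, so that all tables can be listed and counted; `avoid-cong` makes
  -- the passage from a function to its table harmless.
  Table : Set
  Table = Vec (Vec (Fin n) M) n

  entryOf : Table → Fin n → Fin M → Fin n
  entryOf t x c = lookup (lookup t x) c

  -- A transition table with a target state and a current state.
  Chase : Set
  Chase = Table × Fin n × Fin n

  weight : ℕ → Chase → ℕ
  weight L (t , v , x) = avoid (entryOf t) v L x

  -- The target is absorbing: a caught chase keeps weight 0, which `weight-suc` relies on.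
  advance : Fin M → Chase → Chase
  advance c (t , v , x) = t , v , (if does (x Fin.≟ v) then x else entryOf t x c)

  Caught : List (Fin M) → Chase → Set
  Caught w (t , v , x) = Hits (entryOf t) v x w

  weight-suc : ∀ L q → weight (suc L) q ≡ sum λ c → weight L (advance c q)
  weight-suc L (t , v , x) with x Fin.≟ v
  ... | yes refl = sym (sum-zero {M} λ _ → avoid-hit (entryOf t) v L)
  ... | no  _    = refl

  total : ℕ → List Chase → ℕ
  total L qs = ListAction.sum (map (weight L) qs)

  total-suc : ∀ L qs → total (suc L) qs ≡ sum λ c → total L (map (advance c) qs)
  total-suc L []       = sym (sum-zero {M} λ _ → refl)
  total-suc L (q ∷ qs) = trans (cong₂ _+_ (weight-suc L q) (total-suc L qs))
    (sym (∑-distrib-+ (λ c → weight L (advance c q)) _))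

  caught-advance : ∀ c w q → Caught w (advance c q) → Caught (c ∷ w) q
  caught-advance c w (t , v , x) hits with x Fin.≟ v
  ... | yes x≡v = inj₁ x≡v
  ... | no  _   = inj₂ hits

  total<1⇒caught : ∀ qs → total 0 qs < 1 → All (Caught []) qs
  total<1⇒caught []                 _  = []
  total<1⇒caught ((t , v , x) ∷ qs) lt with x Fin.≟ v
  ... | yes x≡v = x≡v ∷ total<1⇒caught qs lt
  ... | no  _   = contradiction lt λ { (s≤s ()) }

  -- Method of conditional expectations: fix the letters one by one, keeping
  -- the expected number of uncaught chases below 1.
  catching-word : ∀ L qs → total L qs < M ^ L → ∃ λ w → length w ≡ L × All (Caught w) qs
  catching-word zero    qs lt = [] , refl , total<1⇒caught qs lt
  catching-word (suc L) qs lt =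
    let c , lt′ = sum<⇒∃< (λ c → total L (map (advance c) qs)) (M ^ L) (subst (_< M ^ suc L) (total-suc L qs) lt)
        w , len , caught = catching-word L (map (advance c) qs) lt′
    in c ∷ w , cong suc len , All.map (λ {q} → caught-advance c w q) (All.map⁻ caught)

  Rare : ℕ → ℕ → Chase → Set
  Rare B L q = 2 ^ B * weight L q ≤ M ^ L

  total-rare : ∀ B L {qs} → All (Rare B L) qs → 2 ^ B * total L qs ≤ length qs * M ^ L
  total-rare B L []                = ≤-reflexive (*-zeroʳ (2 ^ B))
  total-rare B L {q ∷ qs} (r ∷ rs) = ≤-trans (≤-reflexive (*-distribˡ-+ (2 ^ B) (weight L q) _)) (+-mono-≤ r (total-rare B L rs))

  rare? : ∀ B L q → Dec (Rare B L q)
  rare? B L q = 2 ^ B * weight L q ≤? M ^ L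

  chases : List Chase
  chases = cartesianProduct (vectors (vectors (allFin n) M) n) (cartesianProduct (allFin n) (allFin n))

  ∈-chases : ∀ q → q ∈ chases
  ∈-chases (t , v , x) = ∈-cartesianProduct⁺ (∈-vectors (∈-vectors ∈-allFin) t)
    (∈-cartesianProduct⁺ (∈-allFin v) (∈-allFin x))

  length-chases : length chases ≡ (n ^ M) ^ n * (n * n)
  length-chases = begin
    length chases
      ≡⟨ length-cartesianProductWith _,_ (vectors (vectors (allFin n) M) n) _ ⟩
    length (vectors (vectors (allFin n) M) n) * length (cartesianProduct (allFin n) (allFin n))
      ≡⟨ cong₂ _*_ (trans (length-vectors _ n) (cong (_^ n) (length-vectors (allFin n) M)))
                   (length-cartesianProductWith _,_ (allFin n) (allFin n)) ⟩
    (length (allFin n) ^ M) ^ n * (length (allFin n) * length (allFin n))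
      ≡⟨ cong (λ k → (k ^ M) ^ n * (k * k)) (List.length-tabulate id) ⟩
    (n ^ M) ^ n * (n * n) ∎
    where open ≡-Reasoning

  -- The list of all chases includes tables in which the target cannot be reached, so it is first
  -- filtered by `Rare`. Each remaining chase is avoided by a fraction of at most 2^-`B` of the
  -- words, and there are fewer than 2^`B` of them, so the expected number of uncaught chases is
  -- below 1.
  rare-catching-word : .{{_ : NonZero M}} → ∀ B L → length chases < 2 ^ B →
    ∃ λ w → length w ≡ L × (∀ q → Rare B L q → Caught w q)
  rare-catching-word B L few =
    let w , len , caught = catching-word L qs total< in
    w , len , λ q r → All.lookup caught (∈-filter⁺ (rare? B L) (∈-chases q) r)
    where
    open ≤-Reasoning
    qs = filter (rare? B L) chases
    instance _ = m^n≢0 M L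
    total< : total L qs < M ^ L
    total< = *-cancelˡ-< (2 ^ B) _ _ (begin-strict
      2 ^ B * total L qs     ≤⟨ total-rare B L (All.all-filter (rare? B L) chases) ⟩
      length qs * M ^ L      ≤⟨ *-monoˡ-≤ (M ^ L) (List.length-filter (rare? B L) chases) ⟩
      length chases * M ^ L  <⟨ *-monoˡ-< (M ^ L) few ⟩
      2 ^ B * M ^ L ∎)

-- Exploration words for all graphs up to a given size.

n≤2^n : ∀ n → n ≤ 2 ^ n
n≤2^n zero    = z≤n
n≤2^n (suc n) = begin
  1 + n          ≤⟨ +-mono-≤ (m^n>0 2 n) (n≤2^n n) ⟩
  2 ^ n + 2 ^ n  ≡⟨ cong (2 ^ n +_) (+-identityʳ _) ⟨
  2 * 2 ^ n ∎
  where open ≤-Reasoning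

-- 2 ^ stages N exceeds the number of chases; a block of N * (2 * N * (N * N))
-- letters halves the fraction of words that still avoid the target.
stages : ℕ → ℕ
stages N = suc (N * N * N + (N + N))

-- Bounding every base `n` by `2 ^ N` gives a power of two whose exponent is at most N³ + 2N, one
-- less than `stages N`.
few-chases : ∀ {n} N → n ≤ N → length (chases {n} {N}) < 2 ^ stages N
few-chases {n} N n≤N = begin-strict
  length (chases {n} {N})        ≡⟨ length-chases {n} {N} ⟩
  (n ^ N) ^ n * (n * n)          ≡⟨ cong (_* (n * n)) (^-*-assoc n N n) ⟩
  n ^ (N * n) * (n * n)          ≤⟨ *-mono-≤ (^-monoˡ-≤ (N * n) n≤2^N) (*-mono-≤ n≤2^N n≤2^N) ⟩
  (2 ^ N) ^ (N * n) * (2 ^ N * 2 ^ N) ≡⟨ cong₂ _*_ (^-*-assoc 2 N (N * n)) (sym (^-distribˡ-+-* 2 N N)) ⟩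
  2 ^ (N * (N * n)) * 2 ^ (N + N) ≡⟨ ^-distribˡ-+-* 2 (N * (N * n)) (N + N) ⟨
  2 ^ (N * (N * n) + (N + N))    ≤⟨ ^-monoʳ-≤ 2 (+-monoˡ-≤ (N + N) (≤-trans (*-monoʳ-≤ N (*-monoʳ-≤ N n≤N)) (≤-reflexive (sym (*-assoc N N N))))) ⟩
  2 ^ (N * N * N + (N + N))      <⟨ ^-monoʳ-< 2 (s≤s (s≤s z≤n)) (n<1+n (N * N * N + (N + N))) ⟩
  2 ^ stages N ∎
  where
  open ≤-Reasoning
  n≤2^N = ≤-trans (n≤2^n n) (^-monoʳ-≤ 2 n≤N)

wordLength : ℕ → ℕ
wordLength N = stages N * (N * (2 * N * (N * N)))

walk : ∀ {n} → PortGraph n → Fin n → List ℕ → Fin n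
walk G = List.foldl (hop G)

hits-cong : ∀ {n M} (G : PortGraph n) (f : Fin n → Fin M → Fin n) → (∀ x c → f x c ≡ hop G x (toℕ c)) →
  ∀ v x w → Hits f v x w → Hits (hop G) v x (map toℕ w)
hits-cong G f f≗ v x []      h        = h
hits-cong G f f≗ v x (c ∷ w) (inj₁ h) = inj₁ h
hits-cong G f f≗ v x (c ∷ w) (inj₂ h) rewrite f≗ x c = inj₂ (hits-cong G f f≗ v (hop G x (toℕ c)) w h)

hits-++ : ∀ {n} (G : PortGraph n) v x w {w′} → Hits (hop G) v (walk G x w) w′ → Hits (hop G) v x (w ++ w′)
hits-++ G v x []      h = h
hits-++ G v x (c ∷ w) h = inj₂ (hits-++ G v (hop G x c) w h)

++-hits : ∀ {n} (G : PortGraph n) v x w {w′} → Hits (hop G) v x w → Hits (hop G) v x (w ++ w′)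
++-hits G v x []      {w′} refl     = hits-now w′
++-hits G v x (c ∷ w)      (inj₁ h) = inj₁ h
++-hits G v x (c ∷ w)      (inj₂ h) = inj₂ (++-hits G v (hop G x c) w h)

sized-word : ∀ N .{{_ : NonZero N}} n → n ≤ N → ∃ λ w → length w ≡ wordLength N ×
  (∀ (G : PortGraph n) → Connected G → ∀ u v → Hits (hop G) v u w)
sized-word N n n≤N =
  let w , len , caught = rare-catching-word {n} {N} (stages N) (wordLength N) (few-chases N n≤N) in
  map toℕ w , trans (List.length-map toℕ w) len , λ G connected u v →
  let f = λ x c → hop G x (toℕ c)
      t = tabulate λ x → tabulate (f x)
      table≗ : ∀ x c → entryOf t x c ≡ f x c
      table≗ = λ x c → trans (cong (λ r → lookup r c) (lookup∘tabulate (λ x → tabulate (f x)) x)) (lookup∘tabulate (f x) c)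
      rare : Rare (stages N) (wordLength N) (t , v , u)
      rare = subst (λ a → 2 ^ stages N * a ≤ N ^ wordLength N) (sym (avoid-cong table≗ v (wordLength N) u))
               (avoid-rarely G n≤N N n≤N connected (stages N) u v)
  in hits-cong G (entryOf t) table≗ v u w (caught (t , v , u) rare)

-- The exact number of nodes is unknown, so the words for all sizes are concatenated. Each works
-- from any starting node, so it does not matter where the preceding ones have led.
universal-word≤ : ∀ N .{{_ : NonZero N}} m → m ≤ N → ∃ λ w → length w ≡ suc m * wordLength N ×
  (∀ {n} (G : PortGraph n) → Connected G → n ≤ m → ∀ u v → Hits (hop G) v u w)
universal-word≤ N zero 0≤N =
  let w , len , hits = sized-word N 0 0≤N in
  w , trans len (sym (+-identityʳ _)) , λ { G connected z≤n → hits G connected }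
universal-word≤ N (suc m) m<N =
  let w , len , hits = universal-word≤ N m (<⇒≤ m<N)
      w′ , len′ , hits′ = sized-word N (suc m) m<N
  in w′ ++ w , trans (List.length-++ w′) (cong₂ _+_ len′ len) ,
     λ {n} G connected n≤1+m u v → extend w w′ hits hits′ G connected n≤1+m u v
  where
  extend : ∀ w w′ → (∀ {n} (G : PortGraph n) → Connected G → n ≤ m → ∀ u v → Hits (hop G) v u w) →
    (∀ (G : PortGraph (suc m)) → Connected G → ∀ u v → Hits (hop G) v u w′) →
    ∀ {n} (G : PortGraph n) → Connected G → n ≤ suc m → ∀ u v → Hits (hop G) v u (w′ ++ w)
  extend w w′ hits hits′ {n} G connected n≤1+m u v with m≤n⇒m<n∨m≡n n≤1+m
  ... | inj₁ (s≤s n≤m) = hits-++ G v u w′ (hits G connected n≤m (walk G u w′) v)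
  ... | inj₂ refl      = ++-hits G v u w′ (hits′ G connected u v)

universal-word : ∀ N .{{_ : NonZero N}} → ∃ λ w → length w ≡ suc N * wordLength N ×
  (∀ {n} (G : PortGraph n) → Connected G → n ≤ N → ∀ u v → Hits (hop G) v u w)
universal-word N = universal-word≤ N N ≤-refl

-- The agents' program

data Command : Set where
  idle listen undo : Command
  step : ℕ → Command
  halt : ℕ → Command

-- up m asks for a label below 2 ^ suc m; down lo j is asked when the smallest
-- label is known to lie in [lo, lo + 2 ^ suc j).
data Query : Set where
  up   : ℕ → Query
  down : ℕ → ℕ → Query

threshold : Query → ℕ
threshold (up m)      = 2 ^ suc m
threshold (down lo j) = lo + 2 ^ j

proceed : Query → Bool → Query ⊎ ℕ
proceed (up m)            true  = inj₁ (down 0 m)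
proceed (up m)            false = inj₁ (up (suc m))
proceed (down lo zero)    b     = inj₂ (if b then lo else lo + 1)
proceed (down lo (suc j)) b     = inj₁ (down (if b then lo else lo + 2 ^ suc j) j)

-- tour o ws: the leader is o and ws are the steps that remain to be made.
data Phase : Set where
  init : Phase
  ask  : Query → Phase
  tour : ℕ → List ℕ → Phase

-- The flag records a positive answer in a query, and membership in the
-- leader's group in the tour.  If pending is set, the last command was a step
-- and the entry port still has to be pushed on the trail.
record State : Set where
  constructor state
  field
    phase   : Phase
    flag    : Bool
    script  : List Command
    trail   : List (Maybe ℕ)
    pending : Bool

pushIf : Bool → Maybe ℕ → List (Maybe ℕ) → List (Maybe ℕ)
pushIf true  e tr = e ∷ tr
pushIf false e tr = tr

-- A `nothing` on the trail records a step through a missing port, which is undone by staying.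
retreat : List (Maybe ℕ) → Action
retreat []            = stay
retreat (nothing ∷ _) = stay
retreat (just p ∷ _)  = move p

module Machine (w : List ℕ) where

  D E : ℕ
  D = length w
  E = suc D

  pad : ℕ → List Command
  pad m = replicate m idle

  -- Offsets include the E idle rounds that load puts before the body.
  -- The clocks of two agents differ by at most E, so offset r of one agent's slot
  -- is within E of offset r of another's.  A walk made at offsets 2E to 2E + D
  -- therefore falls into every listening window, which starts at E; a tour step
  -- made at 2E is over for everybody at 4E; and during the first E idle rounds
  -- the positions do not depend on the phase just entered.
  body : Phase → Bool → List Command
  body init              _     = []
  body (ask _)           true  = pad E ++ map step w ++ replicate D undo ++ pad (E + E) ++ []
  body (ask _)           false = replicate (E + (D + (D + (E + E)))) listen ++ []
  body (tour o [])       _     = halt o ∷ []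
  body (tour o (p ∷ ws)) true  = pad E ++ step p ∷ pad (E + E) ++ []
  body (tour o (p ∷ ws)) false = pad (E + (E + E)) ++ listen ∷ []

  -- The duration of a slot including its `E` idle rounds. It is the same for both flags, so the
  -- clock differences never change.
  askLength tourLength : ℕ
  askLength = E + (E + (D + (D + (E + E))))
  tourLength = E + (E + suc (E + E))

  -- In a query an agent beeps exactly when its own label is below the threshold; at the beginning
  -- of the tour the group consists of the owner of `o`.
  enter : ℕ → Query ⊎ ℕ → Phase × Bool
  enter ℓ (inj₁ q) = ask q , (ℓ <ᵇ threshold q)
  enter ℓ (inj₂ o) = tour o w , (ℓ ≡ᵇ o)

  transition : ℕ → Phase → Bool → Phase × Bool
  transition ℓ init              b = enter ℓ (inj₁ (up 0))
  transition ℓ (ask q)           b = enter ℓ (proceed q b)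
  transition ℓ (tour o [])       b = tour o [] , b
  transition ℓ (tour o (_ ∷ ws)) b = tour o ws , b

  load : Phase × Bool → List (Maybe ℕ) → Bool → State
  load (ph , b) tr pd = state ph b (pad E ++ body ph b) tr pd

  -- The next phase is loaded in the round of the last command, so no round passes between slots.
  settle : ℕ → Phase → Bool → List Command → List (Maybe ℕ) → Bool → State
  settle ℓ ph b []       tr pd = load (transition ℓ ph b) tr pd
  settle ℓ ph b (c ∷ cs) tr pd = state ph b (c ∷ cs) tr pd

  execute : ℕ → Phase → Bool → Command → List Command → List (Maybe ℕ) → ℕ → Action × State
  execute ℓ ph b idle     cs tr n = stay , settle ℓ ph b cs tr false
  execute ℓ ph b listen   cs tr n = stay , settle ℓ ph (b ∨ (2 ≤ᵇ n)) cs tr false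
  execute ℓ ph b (step p) cs tr n = move p , settle ℓ ph b cs tr true
  execute ℓ ph b undo     cs tr n = retreat tr , settle ℓ ph b cs (List.drop 1 tr) false
  execute ℓ ph b (halt o) cs tr n = stop o , settle ℓ ph b cs tr false

  react : ℕ → State → Obs → Action × State
  react ℓ s@(state ph b []       tr pd) _           = stay , s
  react ℓ (state ph b (c ∷ cs) tr pd)   (obs _ e n) = execute ℓ ph b c cs (pushIf pd e tr) n

  -- The leading `idle` keeps the script nonempty for every `w`; on an empty script `react` would
  -- stay for ever. It is also the extra round in `E`.
  initial : State
  initial = state init false (idle ∷ map step w ++ replicate D undo ++ []) [] false

  run : ℕ → List Obs → Action × State
  run ℓ = foldl (λ s → react ℓ (proj₂ s)) (stay , initial)

  run-snoc : ∀ ℓ h o → run ℓ (h ++ [ o ]) ≡ react ℓ (proj₂ (run ℓ h)) o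
  run-snoc ℓ h o = List.foldl-++ (λ s → react ℓ (proj₂ s)) (stay , initial) h [ o ]

gatherer : (ℕ → List ℕ) → Algorithm
gatherer word N ℓ h = proj₁ (Machine.run (word N) ℓ h)

-- A single agent following its script.

true⇒T : ∀ {b} → b ≡ true → T b
true⇒T = Equivalence.from T-≡

T⇒true : ∀ {b} → T b → b ≡ true
T⇒true = Equivalence.to T-≡

∨-introʳ : ∀ b {c} → c ≡ true → (b ∨ c) ≡ true
∨-introʳ b refl = ∨-zeroʳ b

arrival : ∀ {n} → PortGraph n → Fin n → ℕ → Maybe ℕ
arrival G v p with p <? deg G v
... | yes p<d = just (toℕ (back G v (fromℕ< p<d)))
... | no  _   = nothing

unhop : ∀ {n} → PortGraph n → Fin n → Maybe ℕ → Fin n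
unhop G v nothing  = v
unhop G v (just p) = hop G v p

unhop-hop : ∀ {n} (G : PortGraph n) v p → unhop G (hop G v p) (arrival G v p) ≡ v
unhop-hop G v p with p <? deg G v
... | yes p<d = trans (hop-port G _ (back G v _)) (nbr-back G v _)
... | no  _   = refl

arrivals : ∀ {n} → PortGraph n → Fin n → List ℕ → List (Maybe ℕ) → List (Maybe ℕ)
arrivals G v []       tr = tr
arrivals G v (p ∷ ws) tr = arrivals G (hop G v p) ws (arrival G v p ∷ tr)

replicate-shift : ∀ {A : Set} m (x : A) xs → replicate m x ++ x ∷ xs ≡ x ∷ replicate m x ++ xs
replicate-shift zero    x xs = refl
replicate-shift (suc m) x xs = cong (x ∷_) (replicate-shift m x xs)

module Run (word : ℕ → List ℕ) (N : ℕ) {n : ℕ} (G : PortGraph n)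
           (k : ℕ) (label : Fin k → ℕ) (start : Fin k → Fin n) (wake : Fin k → Maybe ℕ) where

  open Execution (gatherer word) N G k label start wake renaming (step to nextConfig)
  open Machine (word N)

  countNow : ℕ → Fin k → ℕ
  countNow t i = countAt (config t) (pos (config t i))

  -- The invariant at the beginning of round `t`. The field `fires` replaces a condition on the
  -- mode, so it also covers a dormant agent that wakes up in this very round, with empty `history`.
  -- The index `tr` is the trail once the pending entry port has been pushed.
  record At (i : Fin k) (t : ℕ) (ph : Phase) (b : Bool) (cs : List Command)
            (tr : List (Maybe ℕ)) (v : Fin n) : Set where
    field
      history   : List Obs
      fires     : config (suc t) i ≡ act i (config t i) (history ++ [ observe (config t) i ])
      running   : isStopped (mode (config t i)) ≡ false
      stored    : List (Maybe ℕ)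
      pending   : Bool
      state≡    : proj₂ (run (label i) history) ≡ state ph b cs stored pending
      trail≡    : pushIf pending (lastEntry (config t i)) stored ≡ tr
      position≡ : pos (config t i) ≡ v

  open At

  -- Mirrors `settle`: an exhausted script stands for the beginning of the next slot.
  Next : Fin k → ℕ → Phase → Bool → List Command → List (Maybe ℕ) → Fin n → Set
  Next i t ph b []       tr v = let ph′ , b′ = transition (label i) ph b in
                                At i t ph′ b′ (pad E ++ body ph′ b′) tr v
  Next i t ph b (c ∷ cs) tr v = At i t ph b (c ∷ cs) tr v

  next-position : ∀ {i t ph b tr v} cs → Next i t ph b cs tr v → pos (config t i) ≡ v
  next-position []       a = position≡ a
  next-position (_ ∷ _) a = position≡ a

  fire : ∀ {i t ph b c cs tr v} (a : At i t ph b (c ∷ cs) tr v) →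
    let r = execute (label i) ph b c cs tr (countNow t i) in
    run (label i) (history a ++ [ observe (config t) i ]) ≡ r ×
    config (suc t) i ≡ perform (config t i) (history a ++ [ observe (config t) i ]) (proj₁ r)
  fire {i} {t} {ph} {b} {c} {cs} a = run≡ , trans (fires a) (cong (perform (config t i) _ ∘ proj₁) run≡)
    where
    run≡ = trans (run-snoc (label i) (history a) _)
      (trans (cong (λ s → react (label i) s (observe (config t) i)) (state≡ a))
             (cong (λ tr → execute (label i) ph b c cs tr (countNow t i)) (trail≡ a)))

  proceed-active : ∀ {i t h} → mode (config t i) ≡ active h →
    config (suc t) i ≡ act i (config t i) (h ++ [ observe (config t) i ])
  proceed-active {i} {t} eq = cong (stepAgent t (config t) i) eq

  resume : ∀ {i t ph b tr v tr₀ pd} h cs → config t i ≡ ⟨ v , lastEntry (config t i) , active h ⟩ →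
    proj₂ (run (label i) h) ≡ settle (label i) ph b cs tr₀ pd →
    pushIf pd (lastEntry (config t i)) tr₀ ≡ tr → Next i t ph b cs tr v
  -- The two clauses have equal bodies; the split is what makes `Next` and `settle` compute.
  resume {i} {t} h [] cfg st tr≡ = record
    { history = h ; fires = proceed-active {i} {t} (cong mode cfg) ; running = cong (isStopped ∘ mode) cfg
    ; state≡ = st ; trail≡ = tr≡ ; position≡ = cong pos cfg }
  resume {i} {t} h (_ ∷ _) cfg st tr≡ = record
    { history = h ; fires = proceed-active {i} {t} (cong mode cfg) ; running = cong (isStopped ∘ mode) cfg
    ; state≡ = st ; trail≡ = tr≡ ; position≡ = cong pos cfg }

  perform-move : ∀ s h p → perform s h (move p) ≡ ⟨ hop G (pos s) p , arrival G (pos s) p , active h ⟩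
  perform-move s h p with p <? deg G (pos s)
  ... | yes _ = refl
  ... | no  _ = refl

  relabel : ∀ {s : AState n} {v e m} → s ≡ ⟨ v , e , m ⟩ → s ≡ ⟨ v , lastEntry s , m ⟩
  relabel refl = refl

  stand : ∀ {i t ph b cs tr v h} (a : At i t ph b cs tr v) → config (suc t) i ≡ perform (config t i) h stay →
    config (suc t) i ≡ ⟨ v , lastEntry (config (suc t) i) , active h ⟩
  stand {h = h} a cfg = relabel (trans cfg (cong (λ v → ⟨ v , nothing , active h ⟩) (position≡ a)))

  do-idle : ∀ {i t ph b cs tr v} → At i t ph b (idle ∷ cs) tr v → Next i (suc t) ph b cs tr v
  do-idle {cs = cs} a with fire a
  ... | run≡ , cfg = resume _ cs (stand a cfg) (cong proj₂ run≡) refl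

  do-listen : ∀ {i t ph b cs tr v} → At i t ph b (listen ∷ cs) tr v →
    Next i (suc t) ph (b ∨ (2 ≤ᵇ countNow t i)) cs tr v
  do-listen {cs = cs} a with fire a
  ... | run≡ , cfg = resume _ cs (stand a cfg) (cong proj₂ run≡) refl

  do-step : ∀ {i t ph b p cs tr v} → At i t ph b (step p ∷ cs) tr v →
    Next i (suc t) ph b cs (arrival G v p ∷ tr) (hop G v p)
  do-step {i} {t} {p = p} {cs} {tr} {v} a with fire a
  ... | run≡ , cfg = resume _ cs (relabel cfg′) (cong proj₂ run≡) (cong (_∷ tr) (cong lastEntry cfg′))
    where
    cfg′ : config (suc t) i ≡ ⟨ hop G v p , arrival G v p , active (history a ++ [ observe (config t) i ]) ⟩
    cfg′ = trans cfg (trans (perform-move (config t i) _ p)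
      (cong (λ v → ⟨ hop G v p , arrival G v p , _ ⟩) (position≡ a)))

  do-undo : ∀ {i t ph b e cs tr v} → At i t ph b (undo ∷ cs) (e ∷ tr) v →
    Next i (suc t) ph b cs tr (unhop G v e)
  do-undo {e = nothing} {cs} a with fire a
  ... | run≡ , cfg = resume _ cs (stand a cfg) (cong proj₂ run≡) refl
  do-undo {i} {t} {e = just p} {cs} {tr} {v} a with fire a
  ... | run≡ , cfg = resume _ cs (relabel cfg′) (cong proj₂ run≡) refl
    where
    cfg′ : config (suc t) i ≡ ⟨ hop G v p , arrival G v p , active (history a ++ [ observe (config t) i ]) ⟩
    cfg′ = trans cfg (trans (perform-move (config t i) _ p)
      (cong (λ v → ⟨ hop G v p , arrival G v p , _ ⟩) (position≡ a)))

  do-halt : ∀ {i t ph b o cs tr v} → At i t ph b (halt o ∷ cs) tr v →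
    config (suc t) i ≡ ⟨ v , nothing , stopped o ⟩
  do-halt a with fire a
  ... | run≡ , cfg = trans cfg (cong (λ v → ⟨ v , _ , _ ⟩) (position≡ a))

  Still : Fin k → ℕ → ℕ → Fin n → Set
  Still i t m v = ∀ o → o ≤ m → pos (config (t + o) i) ≡ v

  at+0 : ∀ i t {v} → pos (config t i) ≡ v → pos (config (t + 0) i) ≡ v
  at+0 i t {v} = subst (λ s → pos (config s i) ≡ v) (sym (+-identityʳ t))

  still-0 : ∀ i t {v} → pos (config t i) ≡ v → Still i t 0 v
  still-0 i t at o z≤n = at+0 i t at

  still-suc : ∀ i t {m v} → pos (config t i) ≡ v → Still i (suc t) m v → Still i t (suc m) v
  still-suc i t at rest zero    _         = at+0 i t at
  still-suc i t {v = v} at rest (suc o) (s≤s o≤m) =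
    subst (λ s → pos (config s i) ≡ v) (sym (+-suc t o)) (rest o o≤m)

  still-+ : ∀ i t m {m′ v} → Still i t m v → Still i (t + m) m′ v → Still i t (m + m′) v
  still-+ i t m {m′} {v} s s′ o o≤ with ≤-total o m
  ... | inj₁ o≤m = s o o≤m
  ... | inj₂ m≤o = subst (λ s → pos (config s i) ≡ v)
          (trans (+-assoc t m _) (cong (t +_) (m+[n∸m]≡n m≤o)))
          (s′ (o ∸ m) (≤-trans (∸-monoˡ-≤ m o≤) (≤-reflexive (m+n∸m≡n m m′))))

  next-+0 : ∀ {i t ph b cs tr v} → Next i t ph b cs tr v → Next i (t + 0) ph b cs tr v
  next-+0 {i} {t} {ph} {b} {cs} {tr} {v} = subst (λ s → Next i s ph b cs tr v) (sym (+-identityʳ t))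

  next-+suc : ∀ {i t m ph b cs tr v} → Next i (suc t + m) ph b cs tr v → Next i (t + suc m) ph b cs tr v
  next-+suc {i} {t} {m} {ph} {b} {cs} {tr} {v} = subst (λ s → Next i s ph b cs tr v) (sym (+-suc t m))

  abstract

    do-pad : ∀ {i t ph b tr v} m cs → Next i t ph b (pad m ++ cs) tr v →
      Next i (t + m) ph b cs tr v × Still i t m v
    do-pad {i} {t} zero    cs a = next-+0 {cs = cs} a , still-0 i t (next-position cs a)
    do-pad {i} {t} (suc m) cs a = let a′ , still = do-pad m cs (do-idle a) in
      next-+suc {cs = cs} a′ , still-suc i t (position≡ a) still

    do-steps : ∀ {i t ph b tr v} ws cs → Next i t ph b (map step ws ++ cs) tr v →
      Next i (t + length ws) ph b cs (arrivals G v ws tr) (walk G v ws) ×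
      (∀ u → Hits (hop G) u v ws → ∃ λ o → o ≤ length ws × pos (config (t + o) i) ≡ u)
    do-steps {i} {t} []       cs a = next-+0 {cs = cs} a , λ { u refl → 0 , z≤n , at+0 i t (next-position cs a) }
    do-steps {i} {t} (p ∷ ws) cs a with do-steps ws cs (do-step a)
    ... | a′ , visits = next-+suc {cs = cs} a′ , λ
      { u (inj₁ refl) → 0 , z≤n , at+0 i t (position≡ a)
      ; u (inj₂ hits) → let o , o≤ , at = visits u hits in
          suc o , s≤s o≤ , subst (λ s → pos (config s i) ≡ u) (sym (+-suc t o)) at }

    -- Steps are undone last in, first out. `replicate-shift` moves one `undo` to the end, where it
    -- reverses the first step after the induction hypothesis has reversed the others.
    do-undos : ∀ {i t ph b tr v} ws cs →
      Next i t ph b (replicate (length ws) undo ++ cs) (arrivals G v ws tr) (walk G v ws) →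
      Next i (t + length ws) ph b cs tr v
    do-undos []       cs a = next-+0 {cs = cs} a
    do-undos {i} {t} {ph} {b} {tr} {v} (p ∷ ws) cs a =
      next-+suc {cs = cs} (subst (Next i _ ph b cs tr) (unhop-hop G v p) (do-undo
        (do-undos ws (undo ∷ cs) (subst (λ cs → Next i t ph b cs (arrivals G v (p ∷ ws) tr) (walk G v (p ∷ ws)))
          (sym (replicate-shift (length ws) undo cs)) a))))

  record Listened (i : Fin k) (t m : ℕ) (b b′ : Bool) : Set where
    field
      sound    : b′ ≡ true → b ≡ true ⊎ ∃ λ o → o < m × 2 ≤ countNow (t + o) i
      keeps    : b ≡ true → b′ ≡ true
      complete : ∀ o → o < m → 2 ≤ countNow (t + o) i → b′ ≡ true

  open Listened public

  listened-0 : ∀ {i t b} → Listened i t 0 b b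
  listened-0 = record { sound = inj₁ ; keeps = id ; complete = λ { _ () } }

  listened-suc : ∀ {i t m b b′} → Listened i (suc t) m (b ∨ (2 ≤ᵇ countNow t i)) b′ → Listened i t (suc m) b b′
  listened-suc {i} {t} {m} {b} {b′} l = record
    { sound    = λ b′≡ → sound′ b (sound l b′≡)
    ; keeps    = λ { refl → keeps l refl }
    ; complete = complete′ }
    where
    sound′ : ∀ b → (b ∨ (2 ≤ᵇ countNow t i)) ≡ true ⊎ (∃ λ o → o < m × 2 ≤ countNow (suc t + o) i) →
             b ≡ true ⊎ ∃ λ o → o < suc m × 2 ≤ countNow (t + o) i
    sound′ true  _           = inj₁ refl
    sound′ false (inj₁ heard) = inj₂ (0 , s≤s z≤n , subst (λ s → 2 ≤ countNow s i) (sym (+-identityʳ t)) (≤ᵇ⇒≤ 2 _ (true⇒T heard)))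
    sound′ false (inj₂ (o , o<m , two)) = inj₂ (suc o , s≤s o<m , subst (λ s → 2 ≤ countNow s i) (sym (+-suc t o)) two)
    complete′ : ∀ o → o < suc m → 2 ≤ countNow (t + o) i → b′ ≡ true
    complete′ zero    _         two = keeps l (∨-introʳ b (T⇒true (≤⇒≤ᵇ (subst (λ s → 2 ≤ countNow s i) (+-identityʳ t) two))))
    complete′ (suc o) (s≤s o<m) two = complete l o o<m (subst (λ s → 2 ≤ countNow s i) (+-suc t o) two)

  abstract

    do-listens : ∀ {i t ph b tr v} m cs → Next i t ph b (replicate m listen ++ cs) tr v →
      ∃ λ b′ → Next i (t + m) ph b′ cs tr v × Still i t m v × Listened i t m b b′
    do-listens {i} {t} zero    cs a = _ , next-+0 {cs = cs} a , still-0 i t (next-position cs a) , listened-0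
    do-listens {i} {t} (suc m) cs a with do-listens m cs (do-listen a)
    ... | b′ , a′ , still , heard = b′ , next-+suc {cs = cs} a′ , still-suc i t (position≡ a) still , listened-suc heard

-- The joint execution

two-members : ∀ {A : Set} {x y : A} {xs} → x ≢ y → x ∈ xs → y ∈ xs → 2 ≤ length xs
two-members x≢y (here refl) (here refl) = contradiction refl x≢y
two-members {xs = _ ∷ _ ∷ _} x≢y _           (there _)   = s≤s (s≤s z≤n)
two-members {xs = _ ∷ _ ∷ _} x≢y (there _)   _           = s≤s (s≤s z≤n)

another-member : ∀ {k} (i : Fin k) {xs} → Unique xs → 2 ≤ length xs → ∃ λ j → j ≢ i × j ∈ xs
another-member i {x ∷ y ∷ xs} ((x≢y ∷ _) ∷ _) _ with x Fin.≟ i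
... | yes refl = y , x≢y ∘ sym , there (here refl)
... | no  x≢i  = x , x≢i , here refl
another-member i {x ∷ []} _ (s≤s ())

-- Reading o of a clock started at a is reading o′ of a clock started at b.
shift : ∀ {a b e o} → a ≤ b + e → b ≤ a + e → e ≤ o →
        ∃ λ o′ → a + o ≡ b + o′ × o ≤ o′ + e × o′ ≤ o + e
shift {a} {b} {e} {o} a≤ b≤ e≤o = o′ , sym b+o′ , lower , upper
  where
  o′ = a + o ∸ b
  b+o′ : b + o′ ≡ a + o
  b+o′ = m+[n∸m]≡n (≤-trans b≤ (+-monoʳ-≤ a e≤o))
  lower : o ≤ o′ + e
  lower = +-cancelˡ-≤ a _ _ (≤-trans (≤-reflexive (sym b+o′)) (≤-trans (+-monoˡ-≤ o′ b≤)
    (≤-reflexive (trans (+-assoc a e o′) (cong (a +_) (+-comm e o′))))))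
  upper : o′ ≤ o + e
  upper = +-cancelˡ-≤ b _ _ (≤-trans (≤-reflexive b+o′) (≤-trans (+-monoˡ-≤ o a≤)
    (≤-reflexive (trans (+-assoc b e o) (cong (b +_) (+-comm e o))))))

split-offset : ∀ t {e o} → e ≤ o → t + o ≡ t + e + (o ∸ e)
split-offset t {e} {o} e≤o = trans (cong (t +_) (sym (m+[n∸m]≡n e≤o))) (sym (+-assoc t e (o ∸ e)))

∸-bound : ∀ {e o m} → e ≤ o → o < e + m → o ∸ e < m
∸-bound {e} {o} {m} e≤o o< = +-cancelˡ-< e (o ∸ e) m (subst (_< e + m) (sym (m+[n∸m]≡n e≤o)) o<)

-- With `x` = `E`: a beeper that has made `e` steps is at offset 2E + `e`. On a clock differing by
-- at most `E` this lies between E and 4E, inside the listening window.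
beep-window : ∀ x d e o → e < x → x + (x + e) ≤ o + x → o ≤ x + (x + e) + x →
  x ≤ o × o < x + (x + (d + (d + (x + x))))
beep-window x d e o e<x lower upper =
  +-cancelʳ-≤ x _ _ (≤-trans (≤-trans (m≤m+n (x + x) e) (≤-reflexive (+-assoc x x e))) lower) ,
  ≤-<-trans upper (begin-strict
    x + (x + e) + x          ≡⟨ rearrange x e ⟩
    x + x + x + e            <⟨ +-monoʳ-< (x + x + x) e<x ⟩
    x + x + x + x            ≤⟨ m≤m+n _ (d + d) ⟩
    x + x + x + x + (d + d)  ≡⟨ rearrange′ x d ⟩
    x + (x + (d + (d + (x + x)))) ∎)
  where
  open ≤-Reasoning
  rearrange : ∀ x e → x + (x + e) + x ≡ x + x + x + e
  rearrange = solve-∀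
  rearrange′ : ∀ x d → x + x + x + x + (d + d) ≡ x + (x + (d + (d + (x + x))))
  rearrange′ = solve-∀

-- Watchers look at offset 4E, which a group member reads as 3E to 5E: after its step, made at 2E,
-- and no later than its known positions extend.
tour-window : ∀ x o → 1 ≤ x → x + (x + (x + x)) ≤ o + x → o ≤ x + (x + (x + x)) + x →
  ∃ λ o₁ → o₁ ≤ x + x + x × o ≡ suc (x + x) + o₁
tour-window x o 1≤x lower upper = o ∸ suc (x + x) ,
  +-cancelˡ-≤ (suc (x + x)) _ _ (≤-trans (≤-reflexive (m+[n∸m]≡n moved)) (≤-trans upper
    (≤-trans (≤-reflexive (rearrange x)) (n≤1+n _)))) , sym (m+[n∸m]≡n moved)
  where
  rearrange : ∀ x → x + (x + (x + x)) + x ≡ x + x + (x + x + x)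
  rearrange = solve-∀
  rearrange′ : ∀ x → x + (x + (x + x)) ≡ x + x + x + x
  rearrange′ = solve-∀
  moved : suc (x + x) ≤ o
  moved = ≤-trans (≤-trans (+-monoˡ-≤ (x + x) 1≤x) (≤-reflexive (sym (+-assoc x x x))))
    (+-cancelʳ-≤ x _ _ (≤-trans (≤-reflexive (sym (rearrange′ x))) lower))

watch-window : ∀ x → x + (x + (x + x)) + x ≤ x + (x + suc (x + x)) + x
watch-window x = +-monoˡ-≤ x (+-monoʳ-≤ x (+-monoʳ-≤ x (n≤1+n (x + x))))

module Team (word : ℕ → List ℕ) (N : ℕ) {n : ℕ} (G : PortGraph n)
            (k : ℕ) (label : Fin k → ℕ) (start : Fin k → Fin n) (wake : Fin k → Maybe ℕ)
            (universal : ∀ u v → Hits (hop G) v u (word N))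
            (label-injective : Injective _≡_ _≡_ label) (start-injective : Injective _≡_ _≡_ start)
            (imin : Fin k) (minimal : ∀ j → label imin ≤ label j) where

  open Execution (gatherer word) N G k label start wake renaming (step to nextConfig)
  open Machine (word N)
  open Run word N G k label start wake
  open At

  shared⇒2≤count : ∀ t i j → i ≢ j → pos (config t i) ≡ pos (config t j) → 2 ≤ countNow t i
  shared⇒2≤count t i j i≢j same = two-members i≢j
    (∈-filter⁺ at? (∈-allFin i) refl) (∈-filter⁺ at? (∈-allFin j) (sym same))
    where at? = λ j → pos (config t j) Fin.≟ pos (config t i)

  2≤count⇒shared : ∀ t i → 2 ≤ countNow t i → ∃ λ j → j ≢ i × pos (config t j) ≡ pos (config t i)
  2≤count⇒shared t i two =
    let j , j≢i , j∈ = another-member i (Unique.filter⁺ at? (Unique.allFin⁺ k)) two in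
    j , j≢i , proj₂ (∈-filter⁻ at? {xs = allFin k} j∈)
    where at? = λ j → pos (config t j) Fin.≟ pos (config t i)

  -- All agents enter the same slot, each at its own time `τ i`.
  Slot : (Fin k → ℕ) → Phase → (Fin k → Bool) → (Fin k → Fin n) → Set
  Slot τ ph b v = ∀ i → ∃ λ tr → At i (τ i) ph (b i) (pad E ++ body ph (b i)) tr (v i)

  Spread : (Fin k → ℕ) → Set
  Spread τ = ∀ i j → τ i ≤ τ j + E

  spread-+ : ∀ {τ} m → Spread τ → Spread (λ i → τ i + m)
  spread-+ {τ} m spread i j = ≤-trans (+-monoˡ-≤ m (spread i j))
    (≤-reflexive (trans (+-assoc (τ j) E m) (trans (cong (τ j +_) (+-comm E m)) (sym (+-assoc (τ j) m E)))))

  -- A query slot as a shared beep channel.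

  module _ {i : Fin k} {t : ℕ} {q : Query} {tr : List (Maybe ℕ)} {v : Fin n} where

    abstract

      beep : At i t (ask q) true (pad E ++ body (ask q) true) tr v →
        Next i (t + askLength) (ask q) true [] tr v ×
        (∀ u → ∃ λ e → e ≤ D × pos (config (t + (E + (E + e))) i) ≡ u)
      beep a₀ =
        let a₁ , _ = do-pad E _ a₀
            a₂ , _ = do-pad E _ a₁
            a₃ , visits = do-steps (word N) _ a₂
            a₄ = do-undos (word N) _ a₃
            a₅ , _ = do-pad (E + E) [] a₄
        in subst (λ s → Next i s (ask q) true [] tr v) (reassoc t E D (E + E)) a₅ , λ u →
           let e , e≤ , at = visits u (universal v u) in
           e , e≤ , subst (λ s → pos (config s i) ≡ u) (trans (+-assoc (t + E) E e) (+-assoc t E (E + e))) at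
        where
        reassoc : ∀ t e d x → t + e + e + d + d + x ≡ t + (e + (e + (d + (d + x))))
        reassoc = solve-∀

      -- The position is tracked `E` rounds beyond the slot, through the idle prelude of the next
      -- one, because a slower clock may still be inside the current slot.
      hear : At i t (ask q) false (pad E ++ body (ask q) false) tr v →
        ∃ λ b′ → Next i (t + askLength) (ask q) b′ [] tr v × Still i t (askLength + E) v ×
                 Listened i (t + E) (E + (D + (D + (E + E)))) false b′
      hear a₀ =
        let a₁ , s₁ = do-pad E _ a₀
            b′ , a₂ , s₂ , heard = do-listens _ [] a₁
            a₃ = subst (λ s → Next i s (ask q) b′ [] tr v) (+-assoc t E _) a₂
            _ , s₃ = do-pad E _ a₃
        in b′ , a₃ , still-+ i t askLength (still-+ i t E s₁ s₂) s₃ , heard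

  module _ {τ : Fin k → ℕ} {q : Query} (spread : Spread τ)
           (slot : Slot τ (ask q) (λ i → label i <ᵇ threshold q) start) where

    private
      Beeps : Fin k → Bool → Set
      Beeps i b = (label i <ᵇ threshold q) ≡ b

      ready : ∀ i {b} → Beeps i b → ∃ λ tr → At i (τ i) (ask q) b (pad E ++ body (ask q) b) tr (start i)
      ready i refl = slot i

      -- Hence "somebody beeps" is equivalent to "`imin` beeps", and the common answer depends on
      -- the smallest label alone.
      min-beeps : ∀ j → Beeps j true → Beeps imin true
      min-beeps j bj = T⇒true (<⇒<ᵇ (≤-<-trans (minimal j) (<ᵇ⇒< (label j) (threshold q) (true⇒T bj))))

      -- Two listeners sit at distinct starting nodes, so the company seen by a listener must be a
      -- beeper.
      listening-sound : ∀ i → Beeps i false → ∀ o → E ≤ o → o ≤ askLength → 2 ≤ countNow (τ i + o) i → Beeps imin true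
      listening-sound i bi o E≤o o≤ two with 2≤count⇒shared (τ i + o) i two
      ... | j , j≢i , same with label j <ᵇ threshold q in bj
      ...   | true = min-beeps j bj
      ...   | false with shift {τ i} {τ j} {E} {o} (spread i j) (spread j i) E≤o
      ...     | o′ , clock , _ , o′≤ = contradiction (start-injective
        (trans (sym (proj₁ (proj₂ (proj₂ (hear (proj₂ (ready j bj))))) o′ (≤-trans o′≤ (+-monoˡ-≤ E o≤))))
        (trans (subst (λ s → pos (config s j) ≡ pos (config (τ i + o) i)) clock same)
               (proj₁ (proj₂ (proj₂ (hear (proj₂ (ready i bi))))) o (≤-trans o≤ (m≤m+n _ E)))))) j≢i

      abstract

        meet : ∀ i → Beeps i false → Beeps imin true →
          ∃ λ o → E ≤ o × o < askLength × 2 ≤ countNow (τ i + o) i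
        meet i bi bm =
          let e , e≤D , at = proj₂ (beep (proj₂ (ready imin bm))) (start i)
              o , clock , lower , upper = shift {τ imin} {τ i} {E} {E + (E + e)} (spread imin i) (spread i imin) (m≤m+n E (E + e))
              E≤o , o< = beep-window E D e o (s≤s e≤D) lower upper
              _ , _ , still , _ = hear (proj₂ (ready i bi))
              here-now = still o (≤-trans (<⇒≤ o<) (m≤m+n askLength E))
          in o , E≤o , o< , shared⇒2≤count (τ i + o) i imin i≢imin
               (trans here-now (subst (λ s → start i ≡ pos (config s imin)) clock (sym at)))
          where
          i≢imin : i ≢ imin
          i≢imin refl = contradiction (trans (sym bi) bm) λ ()

        listening-complete : ∀ i → Beeps i false → Beeps imin true →
          ∃ λ o → o < E + (D + (D + (E + E))) × 2 ≤ countNow (τ i + E + o) i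
        listening-complete i bi bm = let o , E≤o , o< , two = meet i bi bm in
          o ∸ E , ∸-bound E≤o o< , subst (λ s → 2 ≤ countNow s i) (split-offset (τ i) E≤o) two

      answer : ∀ i b → Beeps i b → ∃ λ tr → Next i (τ i + askLength) (ask q) (label imin <ᵇ threshold q) [] tr (start i)
      answer i true bi = let tr , a = ready i bi in
        tr , subst (λ b → Next i (τ i + askLength) (ask q) b [] tr (start i)) (sym (min-beeps i bi)) (proj₁ (beep a))
      answer i false bi with ready i bi
      ... | tr , a with hear a
      ...   | b′ , next , still , heard = tr , subst (λ b → Next i (τ i + askLength) (ask q) b [] tr (start i)) (correct b′ heard) next
        where
        correct : ∀ b′ → Listened i (τ i + E) (E + (D + (D + (E + E)))) false b′ → b′ ≡ (label imin <ᵇ threshold q)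
        correct b′ heard with label imin <ᵇ threshold q in bm
        ... | true = let o , o< , two = listening-complete i bi bm in complete heard o o< two
        correct false heard | false = refl
        correct true  heard | false with sound heard refl
        ... | inj₂ (o , o< , two) = contradiction (trans (sym bm) (listening-sound i bi (E + o) (m≤m+n E o)
                (<⇒≤ (+-monoʳ-< E o<)) (subst (λ s → 2 ≤ countNow s i) (+-assoc (τ i) E o) two))) λ ()

    abstract

      ask-slot : ∀ i → ∃ λ tr → Next i (τ i + askLength) (ask q) (label imin <ᵇ threshold q) [] tr (start i)
      ask-slot i = answer i _ refl

  -- One slot of the tour.

  module _ {i : Fin k} {t o p : ℕ} {ws : List ℕ} {tr : List (Maybe ℕ)} {v : Fin n} where

    abstract

      follow : At i t (tour o (p ∷ ws)) true (pad E ++ body (tour o (p ∷ ws)) true) tr v →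
        (∃ λ tr′ → Next i (t + tourLength) (tour o (p ∷ ws)) true [] tr′ (hop G v p)) ×
        Still i (t + suc (E + E)) (E + E + E) (hop G v p)
      follow a₀ =
        let a₁ , _ = do-pad E _ a₀
            a₂ , _ = do-pad E _ a₁
            a₃ = do-step a₂
            a₄ , s₄ = do-pad (E + E) [] a₃
            _ , s₅ = do-pad E _ a₄
        in (arrival G v p ∷ tr , subst (λ s → Next i s (tour o (p ∷ ws)) true [] (arrival G v p ∷ tr) (hop G v p)) (reassoc t E) a₄) ,
           subst (λ s → Still i s (E + E + E) (hop G v p)) (reassoc′ t E) (still-+ i (suc (t + E + E)) (E + E) s₄ s₅)
        where
        reassoc : ∀ t e → suc (t + e + e) + (e + e) ≡ t + (e + (e + suc (e + e)))
        reassoc = solve-∀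
        reassoc′ : ∀ t e → suc (t + e + e) ≡ t + suc (e + e)
        reassoc′ = solve-∀

      watch : At i t (tour o (p ∷ ws)) false (pad E ++ body (tour o (p ∷ ws)) false) tr v →
        Next i (t + tourLength) (tour o (p ∷ ws)) (2 ≤ᵇ countNow (t + (E + (E + (E + E)))) i) [] tr v ×
        Still i t (tourLength + E) v
      watch a₀ =
        let a₁ , s₁ = do-pad E _ a₀
            a₂ , s₂ = do-pad (E + (E + E)) _ a₁
            a₃ = subst (λ s → At i s (tour o (p ∷ ws)) false (listen ∷ []) tr v) (+-assoc t E (E + (E + E))) a₂
            a₄ = do-listen a₃
            _ , s₄ = do-pad E _ a₄
        in subst (λ s → Next i s (tour o (p ∷ ws)) (2 ≤ᵇ countNow (t + (E + (E + (E + E)))) i) [] tr v) (reassoc t E) a₄ ,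
           subst (λ m → Still i t m v) (reassoc′ E)
             (still-+ i t (E + (E + (E + E))) (still-+ i t E s₁ s₂) (still-suc i (t + (E + (E + (E + E)))) (position≡ a₃) s₄))
        where
        reassoc : ∀ t e → suc (t + (e + (e + (e + e)))) ≡ t + (e + (e + suc (e + e)))
        reassoc = solve-∀
        reassoc′ : ∀ e → e + (e + (e + e)) + suc e ≡ e + (e + suc (e + e)) + e
        reassoc′ = solve-∀

  module _ {τ : Fin k → ℕ} {o p : ℕ} {ws : List ℕ} {b : Fin k → Bool} {u : Fin n} (spread : Spread τ) (leading : b imin ≡ true)
           (slot : Slot τ (tour o (p ∷ ws)) b (λ i → if b i then u else start i)) where

    private
      watchTime : ℕ
      watchTime = E + (E + (E + E))

      ready : ∀ i {β} → b i ≡ β →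
        ∃ λ tr → At i (τ i) (tour o (p ∷ ws)) β (pad E ++ body (tour o (p ∷ ws)) β) tr (if β then u else start i)
      ready i refl = slot i

      abstract

        group-at : ∀ i j → b j ≡ true → pos (config (τ i + watchTime) j) ≡ hop G u p
        group-at i j bj =
          let o′ , clock , lower , upper = shift {τ i} {τ j} {E} {watchTime} (spread i j) (spread j i) (m≤m+n E _)
              o₁ , o₁≤ , o′≡ = tour-window E o′ (s≤s z≤n) lower upper
          in subst (λ s → pos (config s j) ≡ hop G u p)
               (trans (+-assoc (τ j) (suc (E + E)) o₁) (trans (cong (τ j +_) (sym o′≡)) (sym clock)))
               (proj₂ (follow (proj₂ (ready j bj))) o₁ o₁≤)

        rest-at : ∀ i j → b j ≡ false → pos (config (τ i + watchTime) j) ≡ start j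
        rest-at i j bj =
          let o′ , clock , lower , upper = shift {τ i} {τ j} {E} {watchTime} (spread i j) (spread j i) (m≤m+n E _)
          in subst (λ s → pos (config s j) ≡ start j) (sym clock)
               (proj₂ (watch (proj₂ (ready j bj))) o′ (≤-trans upper (watch-window E)))

        -- At watch time all members are at the new node of the group and all others at their
        -- distinct starts, so company can only mean that the group has arrived.
        capture-sound : ∀ i → b i ≡ false → 2 ≤ countNow (τ i + watchTime) i → start i ≡ hop G u p
        capture-sound i bi two = let j , j≢i , same = 2≤count⇒shared (τ i + watchTime) i two in decide j j≢i same (b j) refl
          where
          decide : ∀ j → j ≢ i → pos (config (τ i + watchTime) j) ≡ pos (config (τ i + watchTime) i) →
                   ∀ β → b j ≡ β → start i ≡ hop G u p
          decide j j≢i same true  bj = trans (sym (rest-at i i bi)) (trans (sym same) (group-at i j bj))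
          decide j j≢i same false bj = contradiction
            (start-injective (trans (sym (rest-at i j bj)) (trans same (rest-at i i bi)))) j≢i

        capture-complete : ∀ i → b i ≡ false → start i ≡ hop G u p → 2 ≤ countNow (τ i + watchTime) i
        capture-complete i bi eq = shared⇒2≤count (τ i + watchTime) i imin i≢imin
          (trans (rest-at i i bi) (trans eq (sym (group-at i imin leading))))
          where
          i≢imin : i ≢ imin
          i≢imin refl = contradiction (trans (sym bi) leading) λ ()

      captured : Fin k → Bool
      captured i = b i ∨ (2 ≤ᵇ countNow (τ i + watchTime) i)

      advance-true : ∀ i → b i ≡ true → captured i ≡ true
      advance-true i bi rewrite bi = refl

      After : Fin k → Bool → Fin n → Set
      After i β v = ∃ λ tr → At i (τ i + tourLength) (tour o ws) β (pad E ++ body (tour o ws) β) tr v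

      uncaught : ∀ i {γ γ′ tr} → γ ≡ γ′ → At i (τ i + tourLength) (tour o ws) γ (pad E ++ body (tour o ws) γ) tr (start i) →
        At i (τ i + tourLength) (tour o ws) γ′ (pad E ++ body (tour o ws) γ′) tr (start i)
      uncaught i refl a = a

      tour-agent : ∀ i β → b i ≡ β → ∀ γ → (2 ≤ᵇ countNow (τ i + watchTime) i) ≡ γ →
        After i (β ∨ γ) (if β ∨ γ then hop G u p else start i)
      tour-agent i true  bi γ     heard = proj₁ (follow (proj₂ (ready i bi)))
      tour-agent i false bi true  heard =
        let tr , a = ready i bi in
        tr , subst (λ v → At i (τ i + tourLength) (tour o ws) true (pad E ++ body (tour o ws) true) tr v)
               (capture-sound i bi (≤ᵇ⇒≤ 2 _ (true⇒T heard))) (uncaught i heard (proj₁ (watch a)))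
      tour-agent i false bi false heard = let tr , a = ready i bi in tr , uncaught i heard (proj₁ (watch a))

      tour-missed : ∀ i β → b i ≡ β → (β ∨ (2 ≤ᵇ countNow (τ i + watchTime) i)) ≡ false →
        b i ≡ false × start i ≢ hop G u p
      tour-missed i false bi missed = bi , λ eq →
        contradiction (trans (sym missed) (T⇒true (≤⇒≤ᵇ (capture-complete i bi eq)))) λ ()

    abstract

      -- Preserves the tour invariant: members stand together, others at their starts. For those
      -- still outside it also records that the group has not reached their start, which `tours`
      -- needs to discard that visit.
      tour-slot : ∃ λ b′ → b′ imin ≡ true × (∀ i → b′ i ≡ false → b i ≡ false × start i ≢ hop G u p) ×
        Slot (λ i → τ i + tourLength) (tour o ws) b′ (λ i → if b′ i then hop G u p else start i)
      tour-slot = captured , advance-true imin leading , (λ i → tour-missed i (b i) refl) , λ i → tour-agent i (b i) refl _ refl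

  -- The whole tour and halting.

  stays-stopped : ∀ i t {v e o} m → config t i ≡ ⟨ v , e , stopped o ⟩ → config (t + m) i ≡ ⟨ v , e , stopped o ⟩
  stays-stopped i t {v} {e} {o} zero    eq = subst (λ s → config s i ≡ ⟨ v , e , stopped o ⟩) (sym (+-identityʳ t)) eq
  stays-stopped i t {v} {e} {o} (suc m) eq =
    subst (λ s → config s i ≡ ⟨ v , e , stopped o ⟩) (sym (+-suc t m))
      (stays-stopped i (suc t) m (trans (cong (stepAgent t (config t) i) (cong mode eq)) eq))

  -- Here `t` is the last round in which the agent is running, the one at which `SolvesWithin`
  -- demands gathering.
  record Halts (i : Fin k) (t : ℕ) : Set where
    field
      until    : isStopped (mode (config t i)) ≡ false
      gathered : Gathered (config t)
      place    : Fin n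
      stops    : config (suc t) i ≡ ⟨ place , nothing , stopped (label imin) ⟩

  open Halts public

  Finish : (Fin k → ℕ) → ℕ → Set
  Finish τ K = ∀ i → Halts i (τ i + K)

  finish-+ : ∀ {τ} m {K} → Finish (λ i → τ i + m) K → Finish τ (m + K)
  finish-+ {τ} m {K} finish i = subst (Halts i) (+-assoc (τ i) m K) (finish i)

  abstract

    halting : ∀ {i t o b tr u} → At i t (tour o []) b (pad E ++ halt o ∷ []) tr u →
      Still i t (E + E) u × isStopped (mode (config (t + E) i)) ≡ false ×
      config (suc (t + E)) i ≡ ⟨ u , nothing , stopped o ⟩
    halting {i} {t} a₀ =
      let a₁ , s₁ = do-pad E _ a₀
          stop≡ = do-halt a₁
      in still-+ i t E s₁ (still-suc i (t + E) (position≡ a₁) λ m _ → cong pos (stays-stopped i (suc (t + E)) m stop≡)) ,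
         running a₁ , stop≡

    -- The `E` idle rounds before `halt` ensure that when the first agent stops, the last step of
    -- every other agent is over; agents that have stopped remain in place.
    final-slot : ∀ {τ b u} → Spread τ → (∀ i → b i ≡ true) →
      Slot τ (tour (label imin) []) b (λ i → if b i then u else start i) → Finish τ E
    final-slot {τ} {b} {u} spread all slot i = record
      { until    = proj₁ (proj₂ (halting (ready i)))
      ; gathered = λ j j′ → trans (together j) (sym (together j′))
      ; place    = u
      ; stops    = proj₂ (proj₂ (halting (ready i))) }
      where
      ready : ∀ j → At j (τ j) (tour (label imin) []) (b j) (pad E ++ halt (label imin) ∷ []) (proj₁ (slot j)) u
      ready j = subst (λ β → At j (τ j) (tour (label imin) []) (b j) (pad E ++ halt (label imin) ∷ []) (proj₁ (slot j)) (if β then u else start j))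
        (all j) (proj₂ (slot j))
      together : ∀ j → pos (config (τ i + E) j) ≡ u
      together j = let o′ , clock , _ , upper = shift {τ i} {τ j} {E} {E} (spread i j) (spread j i) ≤-refl in
        subst (λ s → pos (config s j) ≡ u) (sym clock) (proj₁ (halting (ready j)) o′ upper)

    -- Every outsider's start is different from `u` and still ahead on the remaining walk. Once no
    -- steps remain, `Hits` forces the start to equal `u`, so no outsider is left.
    tours : ∀ ws {τ b u} → Spread τ → b imin ≡ true →
      (∀ i → b i ≡ false → start i ≢ u × Hits (hop G) (start i) u ws) →
      Slot τ (tour (label imin) ws) b (λ i → if b i then u else start i) →
      Finish τ (length ws * tourLength + E)
    tours [] {b = b} spread leading missing slot = final-slot spread (λ i → all i (b i) refl) slot
      where
      all : ∀ i β → b i ≡ β → b i ≡ true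
      all i true  bi = bi
      all i false bi = let apart , hit = missing i bi in contradiction (sym hit) apart
    tours (p ∷ ws) {τ} {b} {u} spread leading missing slot =
      let b′ , leading′ , missed , slot′ = tour-slot {b = b} {u} spread leading slot
          missing′ = λ i b′i → let bi , apart = missed i b′i in
            apart , later (proj₁ (missing i bi)) (proj₂ (missing i bi))
      in subst (Finish τ) (sym (+-assoc tourLength (length ws * tourLength) E))
           (finish-+ tourLength (tours ws {b = b′} (spread-+ tourLength spread) leading′ missing′ slot′))
      where
      later : ∀ {x} → x ≢ u → u ≡ x ⊎ Hits (hop G) x (hop G u p) ws → Hits (hop G) x (hop G u p) ws
      later apart (inj₁ eq)  = contradiction (sym eq) apart
      later apart (inj₂ hit) = hit

    start-tour : ∀ {τ} → Spread τ → Slot τ (tour (label imin) (word N)) (λ i → label i ≡ᵇ label imin) start →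
      Finish τ (D * tourLength + E)
    start-tour {τ} spread slot = tours (word N) {b = λ i → label i ≡ᵇ label imin} {start imin} spread
      (T⇒true (≡⇒≡ᵇ (label imin) _ refl)) missing
      λ i → proj₁ (slot i) , subst (At i (τ i) _ _ _ _) (placed i _ refl) (proj₂ (slot i))
      where
      missing : ∀ i → (label i ≡ᵇ label imin) ≡ false → start i ≢ start imin × Hits (hop G) (start i) (start imin) (word N)
      missing i bi = (λ eq → contradiction (trans (sym bi) (T⇒true (≡⇒≡ᵇ (label i) (label imin) (cong label (start-injective eq))))) λ ()) ,
        universal (start imin) (start i)
      placed : ∀ i β → (label i ≡ᵇ label imin) ≡ β → start i ≡ (if (label i ≡ᵇ label imin) then start imin else start i)
      placed i true  bi rewrite bi = cong start (label-injective (≡ᵇ⇒≡ (label i) (label imin) (true⇒T bi)))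
      placed i false bi rewrite bi = refl

  -- Finding the smallest label by doubling and bisection.

  Asking : (Fin k → ℕ) → Query → Set
  Asking τ q = Slot τ (ask q) (λ i → label i <ᵇ threshold q) start

  tourTime : ℕ
  tourTime = D * tourLength + E

  narrow : ∀ {m lo j} b → (m <ᵇ lo + 2 ^ j) ≡ b → lo ≤ m → m < lo + 2 ^ suc j →
    let lo′ = if b then lo else lo + 2 ^ j in lo′ ≤ m × m < lo′ + 2 ^ j
  narrow {m} {lo} {j} true  b≡ lo≤ m< = lo≤ , <ᵇ⇒< m (lo + 2 ^ j) (true⇒T b≡)
  narrow {m} {lo} {j} false b≡ lo≤ m< = ≮⇒≥ (λ lt → contradiction (trans (sym b≡) (T⇒true (<⇒<ᵇ lt))) λ ()) ,
    subst (m <_) (double lo (2 ^ j)) m<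
    where
    double : ∀ a b → a + 2 * b ≡ a + b + b
    double = solve-∀

  abstract

    -- Each query halves the interval. After the one at `j` = 0 a single integer remains, and
    -- `found` identifies it as the label of `imin`.
    ask-down : ∀ j lo {τ} → Spread τ → lo ≤ label imin → label imin < lo + 2 ^ suc j →
      Asking τ (down lo j) → Finish τ (suc j * askLength + tourTime)
    ask-down zero lo {τ} spread lo≤ min< asking =
      subst (λ m → Finish τ (m + tourTime)) (sym (+-identityʳ askLength))
        (finish-+ askLength (start-tour (spread-+ askLength spread)
          (subst (λ o → Slot (λ i → τ i + askLength) (tour o (word N)) (λ i → label i ≡ᵇ o) start) found (ask-slot spread asking))))
      where
      found : (if (label imin <ᵇ lo + 1) then lo else lo + 1) ≡ label imin
      found = let lower , upper = narrow {j = 0} (label imin <ᵇ lo + 1) refl lo≤ min< in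
        ≤-antisym lower (s≤s⁻¹ (≤-trans upper (≤-reflexive (+-comm _ 1))))
    ask-down (suc j) lo {τ} spread lo≤ min< asking =
      let lower , upper = narrow {j = suc j} (label imin <ᵇ lo + 2 ^ suc j) refl lo≤ min< in
      subst (Finish τ) (sym (+-assoc askLength (suc j * askLength) tourTime))
        (finish-+ askLength (ask-down j _ (spread-+ askLength spread) lower upper (ask-slot spread asking)))

    answered : ∀ {τ q β} → Spread τ → Asking τ q → (label imin <ᵇ threshold q) ≡ β →
      ∀ i → ∃ λ tr → Next i (τ i + askLength) (ask q) β [] tr (start i)
    answered spread asking refl = ask-slot spread asking

    -- The sum `m + r` stays fixed while `m` grows. At most `suc r` doubling queries remain,
    -- followed by at most `suc (m + r)` bisection queries.
    ask-up : ∀ r m {τ} → Spread τ → label imin < 2 ^ suc (m + r) → Asking τ (up m) →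
      ∃ λ K → K ≤ (suc r + suc (m + r)) * askLength + tourTime × Finish τ K
    ask-up r m {τ} spread min< asking = choose _ refl
      where
      choose : ∀ β → (label imin <ᵇ 2 ^ suc m) ≡ β → ∃ λ K → K ≤ (suc r + suc (m + r)) * askLength + tourTime × Finish τ K
      choose true b≡ = _ , bound , finish-+ askLength (ask-down m 0 (spread-+ askLength spread) z≤n
          (<ᵇ⇒< (label imin) _ (true⇒T b≡)) (answered spread asking b≡))
        where
        bound : askLength + (suc m * askLength + tourTime) ≤ (suc r + suc (m + r)) * askLength + tourTime
        bound = ≤-trans (≤-reflexive (sym (+-assoc askLength (suc m * askLength) tourTime)))
          (+-monoˡ-≤ tourTime (*-monoˡ-≤ askLength (s≤s (≤-trans (s≤s (m≤m+n m r)) (m≤n+m _ r)))))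
      choose false b≡ = continue r min<
        where
        bound : ∀ r → askLength + ((suc r + suc (suc m + r)) * askLength + tourTime) ≡ (suc (suc r) + suc (m + suc r)) * askLength + tourTime
        bound r = trans (sym (+-assoc askLength ((suc r + suc (suc m + r)) * askLength) tourTime))
          (cong (λ x → (suc (suc r) + suc x) * askLength + tourTime) (sym (+-suc m r)))
        continue : ∀ r → label imin < 2 ^ suc (m + r) → ∃ λ K → K ≤ (suc r + suc (m + r)) * askLength + tourTime × Finish τ K
        continue zero    lt = contradiction (trans (sym b≡) (T⇒true (<⇒<ᵇ (subst (λ x → label imin < 2 ^ suc x) (+-identityʳ m) lt)))) λ ()
        continue (suc r) lt =
          let K , K≤ , finish = ask-up r (suc m) (spread-+ askLength spread) (subst (λ x → label imin < 2 ^ suc x) (+-suc m r) lt)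
                (answered spread asking b≡)
          in askLength + K , ≤-trans (+-monoʳ-≤ askLength K≤) (≤-reflexive (bound r)) , finish-+ askLength finish

  -- Wake-up and assembly.

  module _ (t0 : ℕ) (woken : ∃ λ i → wake i ≡ just t0) (earliest : ∀ i t → wake i ≡ just t → t0 ≤ t) where

    private
      Asleep : Fin k → ℕ → Set
      Asleep i t = config t i ≡ ⟨ start i , nothing , dormant ⟩

      Starts : Fin k → ℕ → Set
      Starts i t = At i t init false (idle ∷ map step (word N) ++ replicate D undo ++ []) [] (start i)

      Alarm : Fin k → ℕ → Bool
      Alarm i t = adversaryWakes (wake i) t ∨ (2 ≤ᵇ countNow t i)

      stepAsleep : ∀ i t → Asleep i t → config (suc t) i ≡
        (if Alarm i t then act i (config t i) [ observe (config t) i ] else config t i)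
      stepAsleep i t asleep = cong (stepAgent t (config t) i) (cong mode asleep)

      wakes : ∀ i t → Asleep i t → Alarm i t ≡ true → Starts i t
      wakes i t asleep alarm = record
        { history = [] ; fires = trans (stepAsleep i t asleep) (cong (λ b → if b then act i (config t i) [ observe (config t) i ] else config t i) alarm)
        ; running = cong (isStopped ∘ mode) asleep
        ; stored = [] ; pending = false ; state≡ = refl ; trail≡ = refl ; position≡ = cong pos asleep }

      sleeps-on : ∀ i t → Asleep i t → Alarm i t ≡ false → Asleep i (suc t)
      sleeps-on i t asleep alarm = trans (stepAsleep i t asleep)
        (trans (cong (λ b → if b then act i (config t i) [ observe (config t) i ] else config t i) alarm) asleep)

      -- Before `t0` the adversary wakes nobody, and dormant agents at distinct nodes see no
      -- company.
      all-asleep : ∀ t → t ≤ t0 → ∀ i → Asleep i t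
      all-asleep zero    _    i = refl
      all-asleep (suc t) t<t0 i = sleeps-on i t (asleep i) silent
        where
        asleep = all-asleep t (<⇒≤ t<t0)
        alone : ¬ 2 ≤ countNow t i
        alone two = let j , j≢i , same = 2≤count⇒shared t i two in
          j≢i (start-injective (trans (sym (cong pos (asleep j))) (trans same (cong pos (asleep i)))))
        quiet : ∀ γ → (2 ≤ᵇ countNow t i) ≡ γ → γ ≡ false
        quiet true  eq = contradiction (≤ᵇ⇒≤ 2 _ (true⇒T eq)) alone
        quiet false eq = refl
        early : ∀ m → wake i ≡ m → ∀ γ → adversaryWakes m t ≡ γ → γ ≡ false
        early m        _  false _  = refl
        early (just s) w≡ true  eq = contradiction (≤ᵇ⇒≤ s t (true⇒T eq)) (<⇒≱ (≤-trans t<t0 (earliest i s w≡)))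
        silent : Alarm i t ≡ false
        silent = cong₂ _∨_ (early (wake i) refl _ refl) (quiet _ refl)

      first = proj₁ woken

      first-starts : Starts first t0
      first-starts = wakes first t0 (all-asleep t0 ≤-refl first)
        (cong (_∨ (2 ≤ᵇ countNow t0 first)) (trans (cong (λ m → adversaryWakes m t0) (proj₂ woken)) (T⇒true (≤⇒≤ᵇ (≤-refl {t0})))))

      scan : ∀ i r → Asleep i (t0 + r) ⊎ ∃ λ r′ → r′ < r × Starts i (t0 + r′)
      scan i zero    = inj₁ (all-asleep (t0 + 0) (≤-reflexive (+-identityʳ t0)) i)
      scan i (suc r) = extend (scan i r)
        where
        look : Asleep i (t0 + r) → ∀ β → Alarm i (t0 + r) ≡ β → Asleep i (t0 + suc r) ⊎ ∃ λ r′ → r′ < suc r × Starts i (t0 + r′)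
        look asleep true  alarm = inj₂ (r , ≤-refl , wakes i (t0 + r) asleep alarm)
        look asleep false alarm = inj₁ (subst (Asleep i) (sym (+-suc t0 r)) (sleeps-on i (t0 + r) asleep alarm))
        extend : Asleep i (t0 + r) ⊎ (∃ λ r′ → r′ < r × Starts i (t0 + r′)) → Asleep i (t0 + suc r) ⊎ ∃ λ r′ → r′ < suc r × Starts i (t0 + r′)
        extend (inj₁ asleep)             = look asleep _ refl
        extend (inj₂ (r′ , r′<r , starts)) = inj₂ (r′ , m<n⇒m<1+n r′<r , starts)

      abstract

        initial-slot : ∀ {i t} → Starts i t → Next i (t + suc (D + D)) init false [] [] (start i) ×
          (∀ u → ∃ λ e → e ≤ D × pos (config (t + suc e) i) ≡ u)
        initial-slot {i} {t} a₀ =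
          let a₁ = do-idle a₀
              a₂ , visits = do-steps (word N) _ a₁
              a₃ = do-undos (word N) [] a₂
          in subst (λ s → Next i s init false [] [] (start i)) (trans (+-assoc (suc t) D D) (sym (+-suc t (D + D)))) a₃ , λ u →
             let e , e≤ , at = visits u (universal (start i) u) in
             e , e≤ , subst (λ s → pos (config s i) ≡ u) (sym (+-suc t e)) at

    abstract

      -- The first exploration reaches `start i` within `E` rounds of `t0`. If agent `i` is still
      -- asleep then, the visitor wakes it. This is the origin of the bound `E` on clock
      -- differences.
      all-start : ∀ i → ∃ λ r → r ≤ E × Starts i (t0 + r)
      all-start i = found (i Fin.≟ first)
        where
        found : Dec (i ≡ first) → ∃ λ r → r ≤ E × Starts i (t0 + r)
        found (yes refl)  = 0 , z≤n , subst (Starts i) (sym (+-identityʳ t0)) first-starts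
        found (no i≢first) = let e , e≤D , at = proj₂ (initial-slot first-starts) (start i) in
          visited e (s≤s e≤D) at (scan i (suc e))
          where
          visited : ∀ e → suc e ≤ E → pos (config (t0 + suc e) first) ≡ start i →
            Asleep i (t0 + suc e) ⊎ (∃ λ r → r < suc e × Starts i (t0 + r)) → ∃ λ r → r ≤ E × Starts i (t0 + r)
          visited e 1+e≤E at (inj₂ (r , r< , starts)) = r , ≤-trans (<⇒≤ r<) 1+e≤E , starts
          visited e 1+e≤E at (inj₁ asleep) = suc e , 1+e≤E , wakes i (t0 + suc e) asleep
            (∨-introʳ (adversaryWakes (wake i) (t0 + suc e)) (T⇒true (≤⇒≤ᵇ (shared⇒2≤count (t0 + suc e) i first i≢first
              (trans (cong pos asleep) (sym at))))))

      halting-times : ∀ L → label imin < 2 ^ suc L →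
        ∃ λ K → K ≤ E + suc (D + D) + ((suc L + suc L) * askLength + tourTime) ×
        ∀ i → ∃ λ t → Halts i t × t ≤ t0 + K
      halting-times L min< =
        let K , K≤ , finish = ask-up L 0 spread min< (λ i → _ , proj₁ (initial-slot (proj₂ (proj₂ (all-start i))))) in
        E + suc (D + D) + K , +-monoʳ-≤ (E + suc (D + D)) K≤ , λ i → _ , finish i ,
          ≤-trans (+-monoˡ-≤ K (+-monoˡ-≤ (suc (D + D)) (+-monoʳ-≤ t0 (proj₁ (proj₂ (all-start i))))))
            (≤-reflexive (trans (cong (_+ K) (+-assoc t0 E _)) (+-assoc t0 (E + suc (D + D)) K)))
        where
        spread : Spread (λ i → t0 + proj₁ (all-start i) + suc (D + D))
        spread = spread-+ (suc (D + D)) λ i j → ≤-trans (+-monoʳ-≤ t0 (proj₁ (proj₂ (all-start i))))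
          (+-monoˡ-≤ E (m≤m+n t0 _))

    -- Stopping is irreversible, so an agent stops only in the round given by `Halts`; safety and
    -- agreement at arbitrary times reduce to that round.
    solves : ∀ L T → label imin < 2 ^ suc L →
      suc (E + suc (D + D) + ((suc L + suc L) * askLength + tourTime)) ≤ T → SolvesWithin t0 T
    solves L T min< T≥ = safe , (imin , agree) , live
      where
      K = proj₁ (halting-times L min<)
      K≤ = proj₁ (proj₂ (halting-times L min<))
      times = proj₂ (proj₂ (halting-times L min<))
      later : ∀ i {t} → let h = proj₁ (times i) in suc h ≤ t →
        config t i ≡ ⟨ place (proj₁ (proj₂ (times i))) , nothing , stopped (label imin) ⟩
      later i {t} h<t = subst (λ s → config s i ≡ ⟨ place halts , nothing , stopped (label imin) ⟩) (m+[n∸m]≡n h<t)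
        (stays-stopped i (suc (proj₁ (times i))) (t ∸ suc (proj₁ (times i))) (stops halts))
        where halts = proj₁ (proj₂ (times i))
      stopped-on : ∀ i {t t′} → t ≤ t′ → isStopped (mode (config t i)) ≡ true → isStopped (mode (config t′ i)) ≡ true
      stopped-on i {t} {t′} t≤t′ st = keep _ refl
        where
        keep : ∀ m → mode (config t i) ≡ m → isStopped (mode (config t′ i)) ≡ true
        keep (stopped o) eq = subst (λ s → isStopped (mode (config s i)) ≡ true) (m+[n∸m]≡n t≤t′)
          (cong (isStopped ∘ mode) (stays-stopped i t (t′ ∸ t) (cong (λ m → ⟨ pos (config t i) , lastEntry (config t i) , m ⟩) eq)))
        keep dormant     eq = contradiction (trans (sym (cong isStopped eq)) st) λ ()
        keep (active _)  eq = contradiction (trans (sym (cong isStopped eq)) st) λ ()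
      not-before : ∀ i {t} → isStopped (mode (config t i)) ≡ true → proj₁ (times i) < t
      not-before i {t} st = ≰⇒> λ t≤h → contradiction
        (trans (sym (until (proj₁ (proj₂ (times i))))) (stopped-on i t≤h st)) λ ()
      safe : ∀ t i → isStopped (mode (config t i)) ≡ false → isStopped (mode (config (suc t) i)) ≡ true → Gathered (config t)
      safe t i off on = subst (Gathered ∘ config) (≤-antisym (s≤s⁻¹ (not-before i on)) t≤h) (gathered (proj₁ (proj₂ (times i))))
        where
        t≤h : t ≤ proj₁ (times i)
        t≤h = ≮⇒≥ λ h<t → contradiction (trans (sym off) (cong (isStopped ∘ mode) (later i h<t))) λ ()
      agree : ∀ t j o → mode (config t j) ≡ stopped o → o ≡ label imin
      agree t j o eq = unstop (trans (sym eq) (cong mode (later j {t} (not-before j {t} (cong isStopped eq)))))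
        where
        unstop : ∀ {x y} → stopped x ≡ stopped y → x ≡ y
        unstop refl = refl
      live : ∀ i → isStopped (mode (config (t0 + T) i)) ≡ true
      live i = cong (isStopped ∘ mode) (later i (≤-trans (s≤s (≤-trans (proj₂ (proj₂ (times i))) (+-monoʳ-≤ t0 K≤)))
        (≤-trans (≤-reflexive (sym (+-suc t0 _))) (+-monoʳ-≤ t0 T≥))))

-- Running time

<2^bitLength : ∀ x → x < 2 ^ bitLength x
<2^bitLength x = ≰⇒> λ 2^≤x → 1+n≰n (subst (_≤ ⌊log₂ x ⌋) (⌊log₂[2^n]⌋≡n (bitLength x)) (⌊log₂⌋-mono-≤ 2^≤x))

abstract

  universalWord : ℕ → List ℕ
  -- An arbitrary value: the two facts below assume `1 ≤ N`.
  universalWord zero    = []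
  universalWord (suc N) = proj₁ (universal-word (suc N))

  universalWord-length : ∀ N → 1 ≤ N → length (universalWord N) ≡ suc N * wordLength N
  universalWord-length (suc N) _ = proj₁ (proj₂ (universal-word (suc N)))

  universalWord-hits : ∀ N → 1 ≤ N → ∀ {n} (G : PortGraph n) → Connected G → n ≤ N →
    ∀ u v → Hits (hop G) v u (universalWord N)
  universalWord-hits (suc N) _ = proj₂ (proj₂ (universal-word (suc N)))

word-bound : ∀ N z → suc N ≤ z → suc N * wordLength N ≤ 8 * z ^ 8
word-bound N z@(suc z-1) N<z = begin
  suc N * (stages N * (N * (2 * N * (N * N))))
    ≤⟨ *-mono-≤ N<z (*-mono-≤ stages≤ (*-mono-≤ N≤z (*-mono-≤ (*-monoʳ-≤ 2 N≤z) (*-mono-≤ N≤z N≤z)))) ⟩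
  z * (4 * (z * z * z) * (z * (2 * z * (z * z))))
    ≡⟨ collect z ⟩
  8 * z ^ 8 ∎
  where
  open ≤-Reasoning
  N≤z : N ≤ z
  N≤z = <⇒≤ N<z
  z≤z³ : z ≤ z * z * z
  z≤z³ = m≤n*m z (z * z)
  stages≤ : stages N ≤ 4 * (z * z * z)
  stages≤ = begin
    suc (N * N * N + (N + N))
      ≤⟨ s≤s (+-mono-≤ (*-mono-≤ (*-mono-≤ N≤z N≤z) N≤z) (+-mono-≤ N≤z N≤z)) ⟩
    1 + (z * z * z + (z + z))
      ≤⟨ +-mono-≤ (≤-trans (s≤s z≤n) z≤z³) (+-monoʳ-≤ (z * z * z) (+-mono-≤ z≤z³ z≤z³)) ⟩
    z * z * z + (z * z * z + (z * z * z + z * z * z))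
      ≡⟨ four (z * z * z) ⟩
    4 * (z * z * z) ∎
    where
    four : ∀ p → p + (p + (p + p)) ≡ 4 * p
    four = solve-∀
  collect : ∀ z → z * (4 * (z * z * z) * (z * (2 * z * (z * z)))) ≡ 8 * (z * (z * (z * (z * (z * (z * (z * (z * 1))))))))
  collect = solve-∀

-- With every quantity replaced by `x`, the queries cost 12x² and the tour steps 5x²; the remaining
-- 6x is at most 6x², giving 23x².
time-bound : ∀ d b x → 1 ≤ x → suc d ≤ x → b ≤ x → let e = suc d in
  suc (e + suc (d + d) + ((b + b) * (e + (e + (d + (d + (e + e))))) + (d * (e + (e + suc (e + e))) + e))) ≤ 23 * (x * x)
time-bound d b x 1≤x e≤x b≤x = begin
  suc (e + suc (d + d) + ((b + b) * (e + (e + (d + (d + (e + e))))) + (d * (e + (e + suc (e + e))) + e)))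
    ≤⟨ +-mono-≤ 1≤x (+-mono-≤ (+-mono-≤ e≤x (+-mono-≤ 1≤x (+-mono-≤ d≤x d≤x)))
         (+-mono-≤ (*-mono-≤ (+-mono-≤ b≤x b≤x) (+-mono-≤ e≤x (+-mono-≤ e≤x (+-mono-≤ d≤x (+-mono-≤ d≤x (+-mono-≤ e≤x e≤x))))))
           (+-mono-≤ (*-mono-≤ d≤x (+-mono-≤ e≤x (+-mono-≤ e≤x (+-mono-≤ 1≤x (+-mono-≤ e≤x e≤x))))) e≤x))) ⟩
  x + (x + (x + (x + x)) + ((x + x) * (x + (x + (x + (x + (x + x))))) + (x * (x + (x + (x + (x + x)))) + x)))
    ≡⟨ collect x ⟩
  6 * x + 17 * (x * x)
    ≤⟨ +-monoˡ-≤ _ (*-monoʳ-≤ 6 (m≤m*n x x {{>-nonZero 1≤x}})) ⟩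
  6 * (x * x) + 17 * (x * x)
    ≡⟨ *-distribʳ-+ (x * x) 6 17 ⟨
  23 * (x * x) ∎
  where
  open ≤-Reasoning
  e = suc d
  d≤x : d ≤ x
  d≤x = <⇒≤ e≤x
  collect : ∀ x → x + (x + (x + (x + x)) + ((x + x) * (x + (x + (x + (x + (x + x))))) + (x * (x + (x + (x + (x + x)))) + x)))
    ≡ 6 * x + 17 * (x * x)
  collect = solve-∀

-- Taking `x` = 9z⁸ dominates both the word length plus one, at most 8z⁸ + 1, and the bit length.
-- Squaring gives the factor 9 * 9 and the exponent 16.
polynomial-bound : ∀ N L d → d ≡ suc N * wordLength N → let e = suc d in
  suc (e + suc (d + d) + ((suc L + suc L) * (e + (e + (d + (d + (e + e))))) + (d * (e + (e + suc (e + e))) + e)))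
    ≤ 23 * (9 * 9) * (N + suc L) ^ 16
polynomial-bound N L d d≡ = ≤-trans (time-bound d (suc L) x 1≤x d<x L<x)
  (≤-reflexive (trans (square 23 9 (z ^ 8)) (cong (23 * (9 * 9) *_) (sym (^-distribˡ-+-* z 8 8)))))
  where
  z = N + suc L
  x = 9 * z ^ 8
  N<z : suc N ≤ z
  N<z = ≤-trans (s≤s (m≤m+n N L)) (≤-reflexive (sym (+-suc N L)))
  instance
    z≢0 : NonZero z
    z≢0 = >-nonZero (≤-trans (s≤s z≤n) N<z)
  1≤z^8 : 1 ≤ z ^ 8
  1≤z^8 = m^n>0 z 8
  1≤x : 1 ≤ x
  1≤x = ≤-trans 1≤z^8 (m≤m+n (z ^ 8) _)
  d<x : suc d ≤ x
  d<x = +-mono-≤ 1≤z^8 (≤-trans (≤-reflexive d≡) (word-bound N z N<z))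
  L<x : suc L ≤ x
  L<x = ≤-trans (m≤n+m (suc L) N) (≤-trans (m≤m*n z (z ^ 7) {{m^n≢0 z 7}}) (m≤m+n (z ^ 8) _))
  square : ∀ a b y → a * (b * y * (b * y)) ≡ a * (b * b) * (y * y)
  square = solve-∀

theorem1 : Σ Algorithm λ A → Σ ℕ λ c → Σ ℕ λ d →
    ∀ (N n : ℕ) (G : PortGraph n) → Connected G → 2 ≤ N → n ≤ N →
    ∀ (k : ℕ) → 2 ≤ k →
    (label : Fin k → ℕ) → Injective _≡_ _≡_ label → (∀ i → 1 ≤ label i) →
    (start : Fin k → Fin n) → Injective _≡_ _≡_ start →
    (wake : Fin k → Maybe ℕ) →
    ∀ (t0 : ℕ) → ∃ (λ i → wake i ≡ just t0) → (∀ i t → wake i ≡ just t → t0 ≤ t) →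
    ∀ (imin : Fin k) → (∀ j → label imin ≤ label j) →
    Execution.SolvesWithin A N G k label start wake t0
    (c * (N + bitLength (label imin)) ^ d)
theorem1 = gatherer universalWord , 23 * (9 * 9) , 16 ,
  λ N n G connected 2≤N n≤N k _ label label-injective _ start start-injective wake t0 woken earliest imin minimal →
  let 1≤N = ≤-trans (s≤s z≤n) 2≤N in
  Team.solves universalWord N G k label start wake (universalWord-hits N 1≤N G connected n≤N)
    label-injective start-injective imin minimal t0 woken earliest
    ⌊log₂ label imin ⌋ (23 * (9 * 9) * (N + bitLength (label imin)) ^ 16) (<2^bitLength (label imin))
    (polynomial-bound N ⌊log₂ label imin ⌋ (length (universalWord N)) (universalWord-length N 1≤N))
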